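{- There is an algorithm which, given a domino set $\mathcal{R}$, generates in finite time a Sudoku rule $\mathcal{S}$ (with some width $N$ and digit set $\Sigma$) and an initial condition $\mathcal{C}$ (with some period $q$), such that the $\mathcal{R}$-domino problem is solvable on $\mathbb{N}^2$ if and only if the $(\mathcal{S},\mathcal{C})$-Sudoku puzzle is solvable.
   Context: $\mathbb{N}=\{0,1,2,\dots\}$, $e_1=(1,0)$, $e_2=(0,1)$. A domino set is a triple $\mathcal{R}=(\mathcal{W},\mathcal{R}_1,\mathcal{R}_2)$ with $\mathcal{W}$ a non-empty finite set and $\mathcal{R}_1,\mathcal{R}_2\subset\mathcal{W}^2$; an $\mathcal{R}$-domino function on $\Omega\subset\mathbb{Z}^2$ is $\mathcal{T}:\Omega\to\mathcal{W}$ with $(\mathcal{T}(s),\mathcal{T}(s+e_i))\in\mathcal{R}_i$ whenever $s,s+e_i\in\Omega$, and the problem is solvable on $\Omega$ if such $\mathcal{T}$ exists. Sudoku puzzles: given a natural number $N$ (width) and a non-empty finite set $\Sigma$ (digit set), the Sudoku board is $\mathbb{B}=\{0,\dots,N-1\}\times\mathbb{Z}$. For $j,i\in\mathbb{Z}$ the non-vertical line $\ell_{j,i}=\{(n,jn+i):0\le n\le N-1\}$. A Sudoku rule is a set $\mathcal{S}$ of functions $g:\{0,\dots,N-1\}\to\Sigma$. An $\mathcal{S}$-Sudoku solution is $F:\mathbb{B}\to\Sigma$ such that for all $j,i\in\mathbb{Z}$ the function $n\mapsto F(n,jn+i)$ lies in $\mathcal{S}$. An initial condition with period $q\ge1$ is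 a set $\mathcal{C}\subset(\mathbb{Z}/q\mathbb{Z})\times\Sigma$; writing $\pi_q:\mathbb{Z}\to\mathbb{Z}/q\mathbb{Z}$ for reduction mod $q$, an $\mathcal{S}$-Sudoku solution $F$ obeys $\mathcal{C}$ if for every $n\in\{0,\dots,N-1\}$ there is a permutation $\sigma_n$ of $\mathbb{Z}/q\mathbb{Z}$ with $(\sigma_n(\pi_q(m)),F(n,m))\in\mathcal{C}$ for all $m\in\mathbb{Z}$. The $(\mathcal{S},\mathcal{C})$-Sudoku puzzle is solvable if some $\mathcal{S}$-Sudoku solution obeys $\mathcal{C}$. -}

module Defs where

open import Data.Nat as ℕ using (ℕ; suc)
open import Data.Integer as ℤ using (ℤ; _%ℕ_)
open import Data.Integer.DivMod using (n%ℕd<d)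
open import Data.Fin using (Fin; fromℕ<; toℕ)
open import Data.Fin.Permutation using (Permutation′)
open import Data.Bool using (Bool; true)
open import Data.Product using (Σ; Σ-syntax; _×_)
open import Function.Bundles using (Inverse)
open import Relation.Binary.PropositionalEquality using (_≡_)

-- A domino set: W = Fin (suc w) (a non-empty finite set, up to bijection),
-- R₁, R₂ ⊆ W² given by their (decidable) characteristic functions.
record DominoSet : Set where
  field
    w  : ℕ
    R₁ : Fin (suc w) → Fin (suc w) → Bool
    R₂ : Fin (suc w) → Fin (suc w) → Bool

  W : Set
  W = Fin (suc w)

IsDominoFunctionℕ² : (R : DominoSet) → (ℕ → ℕ → DominoSet.W R) → Set
IsDominoFunctionℕ² R T =
  (∀ x y → DominoSet.R₁ R (T x y) (T (suc x) y) ≡ true) ×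
  (∀ x y → DominoSet.R₂ R (T x y) (T x (suc y)) ≡ true)

DominoSolvableℕ² : DominoSet → Set
DominoSolvableℕ² R = Σ[ T ∈ (ℕ → ℕ → DominoSet.W R) ] IsDominoFunctionℕ² R T

-- Width N, digit set Σ = Fin (suc d) (non-empty finite), Sudoku rule S
-- (a set of functions {0..N-1} → Σ, as a characteristic function),
-- initial condition C ⊆ (ℤ/qℤ) × Σ with period q = suc q' ≥ 1,
-- ℤ/qℤ represented by Fin q.
record SudokuPuzzle : Set where
  field
    N  : ℕ
    d  : ℕ
    S  : (Fin N → Fin (suc d)) → Bool
    q' : ℕ
    C  : Fin (suc q') → Fin (suc d) → Bool

  Digit : Set
  Digit = Fin (suc d)

  q : ℕ
  q = suc q'

πq : (q' : ℕ) → ℤ → Fin (suc q')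
πq q' m = fromℕ< (n%ℕd<d m (suc q'))

IsSudokuSolution : (P : SudokuPuzzle) →
  (Fin (SudokuPuzzle.N P) → ℤ → SudokuPuzzle.Digit P) → Set
IsSudokuSolution P F =
  ∀ (j i : ℤ) →
    SudokuPuzzle.S P (λ n → F n (j ℤ.* ℤ.+ (toℕ n) ℤ.+ i)) ≡ true

Obeys : (P : SudokuPuzzle) →
  (Fin (SudokuPuzzle.N P) → ℤ → SudokuPuzzle.Digit P) → Set
Obeys P F =
  ∀ (n : Fin (SudokuPuzzle.N P)) →
    Σ[ σ ∈ Permutation′ (SudokuPuzzle.q P) ]
      (∀ (m : ℤ) →
        SudokuPuzzle.C P (Inverse.to σ (πq (SudokuPuzzle.q' P) m)) (F n m) ≡ true)

SudokuSolvable : SudokuPuzzle → Set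
SudokuSolvable P =
  Σ[ F ∈ (Fin (SudokuPuzzle.N P) → ℤ → SudokuPuzzle.Digit P) ]
    (IsSudokuSolution P F × Obeys P F)

{-# OPTIONS --safe #-}
module Submission where

-- A tiling T of ℕ² is written on the board as F(n,m) = h(m), where h(m) records m mod 35, the last
-- nonzero digits of m in bases 5 and 7, and the tile T(v₅(m), v₇(m)).  On a line, after the common
-- powers of p = 5 and of p = 7 are removed from slope and intercept, the last nonzero digits are
-- those of an affine function A n + B modulo p², and the tiles met at its p-adic levels 0 and 1
-- are domino neighbours; the Sudoku rule says exactly this, and the initial condition says that
-- the residue mod 35 is a permutation of m mod 35.
--
-- Conversely, let F solve the puzzle.  Lines being affine, the permutations are affine, so after a
-- shear and a rescaling the board is normal: the digit at (n,y) is y whenever p ∤ y.  On a normal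
-- board, lines of slope J ≢ 0 meet the multiples of p in every p-th column and read off a "next
-- digit" of these points.  Comparing lines of slopes 2 and 3 shows that this digit is independent
-- of the line, hence of the form y + γ(n); the lines inside the multiples of p force γ to be
-- affine.  So a shear of the multiples of p is again a normal board, and this can be iterated.
-- By the Chinese remainder theorem the levels for 5 and 7 combine, and the tiles found at
-- the levels (a,b) form a tiling of ℕ².

open import Defs
open import Data.Bool using (true; T)
import Data.Bool.Properties as Bool
open import Data.Empty using (⊥; ⊥-elim)
open import Data.Fin using (Fin; zero; suc; toℕ; combine; remQuot)
import Data.Fin.Permutation as Perm
open import Data.Fin.Properties using (toℕ-fromℕ<; toℕ<n; toℕ-injective; remQuot-combine; any?; all?) renaming (_≟_ to _≟F_)
open import Data.Integer using (ℤ; +_; -[1+_]; _+_; _-_; _*_; _^_; -_; 0ℤ; 1ℤ; ∣_∣; _/ℕ_; _%ℕ_)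
import Data.Integer.Properties as ℤₚ
open import Data.Integer.DivMod using (n%ℕd<d; a≡a%ℕn+[a/ℕn]*n)
open import Data.Integer.Divisibility.Signed using (_∣_; divides; _∣?_; ∣-trans)
open import Data.Integer.Tactic.RingSolver using (solve-∀)
open import Data.Nat as ℕ using (ℕ; zero; suc; z≤n; s≤s)
open import Data.Nat.DivMod using (_mod_; m<n⇒m%n≡m)
import Data.Nat.Properties as ℕₚ
open import Data.Product using (Σ-syntax; _×_; _,_; proj₁; proj₂)
open import Data.Sum using (_⊎_; inj₁; inj₂)
open import Data.Unit using (tt)
open import Function.Bundles using (Equivalence; Inverse; _⇔_; mk⇔)
open import Relation.Binary.PropositionalEquality using (_≡_; refl; sym; trans; cong; cong₂; subst; subst₂)
open import Relation.Nullary using (¬_; Dec; yes; no)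
open import Relation.Nullary.Decidable using (_×-dec_; _→-dec_; ¬?; map′; isYes; toWitness; fromWitness; toWitnessFalse)

-- Residues

-- Two members are at least 4 apart, so each isolated predicate can spoil at most one of four
-- consecutive numbers.
Isolated : (ℕ → Set) → Set
Isolated P = ∀ s d → d ℕ.≤ 2 → P s → P (suc d ℕ.+ s) → ⊥

module _ {P : ℕ → Set} (P? : ∀ s → Dec (P s)) (isoP : Isolated P) where

  avoid₁ : ∀ s → Σ[ d ∈ ℕ ] d ℕ.≤ 1 × ¬ P (d ℕ.+ s)
  avoid₁ s with P? s
  ... | no ¬p = 0 , z≤n , ¬p
  ... | yes p = 1 , s≤s z≤n , isoP s 0 z≤n p

module _ {P Q : ℕ → Set} (P? : ∀ s → Dec (P s)) (Q? : ∀ s → Dec (Q s))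
         (isoP : Isolated P) (isoQ : Isolated Q) where

  avoid₂ : ∀ s → Σ[ d ∈ ℕ ] d ℕ.≤ 2 × ¬ P (d ℕ.+ s) × ¬ Q (d ℕ.+ s)
  avoid₂ s with P? s | Q? s
  ... | no ¬p | no ¬q = 0 , z≤n , ¬p , ¬q
  ... | yes p | _ with avoid₁ Q? isoQ (suc s)
  ...   | d , d≤1 , ¬q = suc d , s≤s d≤1 , isoP s d (ℕₚ.m≤n⇒m≤1+n d≤1) p
                       , subst (λ k → ¬ Q k) (ℕₚ.+-suc d s) ¬q
  avoid₂ s | no _ | yes q with avoid₁ P? isoP (suc s)
  ...   | d , d≤1 , ¬p = suc d , s≤s d≤1 , subst (λ k → ¬ P k) (ℕₚ.+-suc d s) ¬p
                       , isoQ s d (ℕₚ.m≤n⇒m≤1+n d≤1) q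

module _ {P Q R : ℕ → Set}
         (P? : ∀ s → Dec (P s)) (Q? : ∀ s → Dec (Q s)) (R? : ∀ s → Dec (R s))
         (isoP : Isolated P) (isoQ : Isolated Q) (isoR : Isolated R) where

  -- Pigeonhole: once a predicate holds at s it fails at the next three numbers, so the search goes
  -- on from s + 1 with one predicate fewer.
  avoid₃ : ∀ s → Σ[ d ∈ ℕ ] d ℕ.≤ 3 × ¬ P (d ℕ.+ s) × ¬ Q (d ℕ.+ s) × ¬ R (d ℕ.+ s)
  avoid₃ s with P? s | Q? s | R? s
  ... | no ¬p | no ¬q | no ¬r = 0 , z≤n , ¬p , ¬q , ¬r
  ... | yes p | _ | _ with avoid₂ Q? R? isoQ isoR (suc s)
  ...   | d , d≤2 , ¬q , ¬r = suc d , s≤s d≤2 , isoP s d d≤2 p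
                            , subst (λ k → ¬ Q k) (ℕₚ.+-suc d s) ¬q
                            , subst (λ k → ¬ R k) (ℕₚ.+-suc d s) ¬r
  avoid₃ s | no _ | yes q | _ with avoid₂ P? R? isoP isoR (suc s)
  ...   | d , d≤2 , ¬p , ¬r = suc d , s≤s d≤2 , subst (λ k → ¬ P k) (ℕₚ.+-suc d s) ¬p
                            , isoQ s d d≤2 q
                            , subst (λ k → ¬ R k) (ℕₚ.+-suc d s) ¬r
  avoid₃ s | no _ | no _ | yes r with avoid₂ P? Q? isoP isoQ (suc s)
  ...   | d , d≤2 , ¬p , ¬q = suc d , s≤s d≤2 , subst (λ k → ¬ P k) (ℕₚ.+-suc d s) ¬p
                            , subst (λ k → ¬ Q k) (ℕₚ.+-suc d s) ¬q
                            , isoR s d d≤2 r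

-- The base p enters through the units 2 and 3 modulo p: the multiples 1, 2, 3, 4 of a number can be
-- cancelled.
record Modulus : Set where
  field
    p          : ℕ
    p-nonZero  : ℕ.NonZero p
    half third : ℤ
    half-inv   : + p ∣ + 2 * half - 1ℤ
    third-inv  : + p ∣ + 3 * third - 1ℤ
    p∤1        : ¬ + p ∣ 1ℤ

module Residues (M : Modulus) where
  open Modulus M public

  π : ℤ
  π = + p

  Null : ℤ → Set
  Null x = π ∣ x

  null? : ∀ x → Dec (Null x)
  null? x = π ∣? x

  -- The `null-lin` lemmas reduce every divisibility below to a linear combination of known
  -- multiples of p, whose correctness is a ring identity.
  null-lin₁ : ∀ {x z} u → Null x → z ≡ u * x → Null z
  null-lin₁ u (divides k refl) z≡ = divides (u * k) (trans z≡ (sym (ℤₚ.*-assoc u k π)))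

  private
    factor₂ : ∀ u v k l q → u * (k * q) + v * (l * q) ≡ (u * k + v * l) * q
    factor₂ = solve-∀

    factor₃ : ∀ u v t k l m q → u * (k * q) + v * (l * q) + t * (m * q) ≡ (u * k + v * l + t * m) * q
    factor₃ = solve-∀

  null-lin₂ : ∀ {x y z} u v → Null x → Null y → z ≡ u * x + v * y → Null z
  null-lin₂ u v (divides k refl) (divides l refl) z≡ =
    divides (u * k + v * l) (trans z≡ (factor₂ u v k l π))

  null-lin₃ : ∀ {x y w z} u v t → Null x → Null y → Null w → z ≡ u * x + v * y + t * w → Null z
  null-lin₃ u v t (divides k refl) (divides l refl) (divides m refl) z≡ =
    divides (u * k + v * l + t * m) (trans z≡ (factor₃ u v t k l m π))

  null-0 : Null 0ℤ
  null-0 = divides 0ℤ refl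

  null-+ : ∀ {x y} → Null x → Null y → Null (x + y)
  null-+ {x} {y} nx ny = null-lin₂ 1ℤ 1ℤ nx ny (eq x y)
    where
    eq : ∀ x y → x + y ≡ 1ℤ * x + 1ℤ * y
    eq = solve-∀

  null-− : ∀ {x y} → Null x → Null y → Null (x - y)
  null-− {x} {y} nx ny = null-lin₂ 1ℤ (- 1ℤ) nx ny (eq x y)
    where
    eq : ∀ x y → x - y ≡ 1ℤ * x + (- 1ℤ) * y
    eq = solve-∀

  null-cong : ∀ {x y} → Null (x - y) → Null y → Null x
  null-cong {x} {y} nxy ny = null-lin₂ 1ℤ 1ℤ nxy ny (eq x y)
    where
    eq : ∀ x y → x ≡ 1ℤ * (x - y) + 1ℤ * y
    eq = solve-∀

  null-cong′ : ∀ {x y} → Null (x - y) → Null x → Null y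
  null-cong′ {x} {y} nxy nx = null-lin₂ (- 1ℤ) 1ℤ nxy nx (eq x y)
    where
    eq : ∀ x y → y ≡ (- 1ℤ) * (x - y) + 1ℤ * x
    eq = solve-∀

  null-2* : ∀ x → Null (+ 2 * x) → Null x
  null-2* x n = null-lin₂ half (- x) n half-inv (eq half x)
    where
    eq : ∀ h x → x ≡ h * (+ 2 * x) + (- x) * (+ 2 * h - 1ℤ)
    eq = solve-∀

  null-3* : ∀ x → Null (+ 3 * x) → Null x
  null-3* x n = null-lin₂ third (- x) n third-inv (eq third x)
    where
    eq : ∀ h x → x ≡ h * (+ 3 * x) + (- x) * (+ 3 * h - 1ℤ)
    eq = solve-∀

  null-small* : ∀ d → d ℕ.≤ 2 → ∀ x → Null (+ suc d * x) → Null x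
  null-small* 0 _ x n = subst Null (ℤₚ.*-identityˡ x) n
  null-small* 1 _ x n = null-2* x n
  null-small* 2 _ x n = null-3* x n
  null-small* (suc (suc (suc _))) (s≤s (s≤s ())) _ _

  ¬null-1 : ¬ Null 1ℤ
  ¬null-1 = p∤1

  ¬null-2 : ¬ Null (+ 2)
  ¬null-2 n = p∤1 (null-2* 1ℤ n)

  ¬null-3 : ¬ Null (+ 3)
  ¬null-3 n = p∤1 (null-3* 1ℤ n)

  ¬null-4 : ¬ Null (+ 4)
  ¬null-4 n = ¬null-2 (null-2* (+ 2) n)

  -- Two zeros at distance 1, 2 or 3 give by subtraction a small multiple of a that vanishes modulo
  -- p, hence a and then b vanish.
  affine-isolated : ∀ {a b} → ¬ (Null a × Null b) → Isolated (λ s → Null (a * + s + b))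
  affine-isolated {a} {b} ¬ab s d d≤2 n n′ = ¬ab (na , null-lin₂ 1ℤ (- + s) n na (eq′ a b (+ s)))
    where
    eq : ∀ a b s d → d * a ≡ 1ℤ * (a * (d + s) + b) + (- 1ℤ) * (a * s + b)
    eq = solve-∀
    na : Null a
    na = null-small* d d≤2 a (null-lin₂ 1ℤ (- 1ℤ) n′ n (eq a b (+ s) (+ suc d)))
    eq′ : ∀ a b s → b ≡ 1ℤ * (a * s + b) + (- s) * a
    eq′ = solve-∀

  -- r is the last nonzero base-p digit of X, unless p² divides X.
  Reads : ℤ → ℤ → Set
  Reads r X = (¬ Null X → Null (r - X)) × (∀ c → X ≡ c * π → ¬ Null c → Null (r - c))

  -- Exactly one factor p: such a point lies one level above the units.
  Simple : ℤ → Set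
  Simple X = Σ[ c ∈ ℤ ] X ≡ c * π × ¬ Null c

-- Normal boards

Column : ℕ → ℤ → Set
Column N n = Σ[ k ∈ ℕ ] k ℕ.< N × n ≡ + k

module Boards (M : Modulus) (N : ℕ) (wide : 12 ℕ.* Modulus.p M ℕ.≤ N) where
  open Residues M

  4≤N : 4 ℕ.≤ N
  4≤N = ℕₚ.≤-trans (ℕₚ.≤-trans (ℕₚ.m≤m+n 4 8) (ℕₚ.m≤m*n 12 p {{p-nonZero}})) wide

  small-column : ∀ k → k ℕ.≤ 3 → Column N (+ k)
  small-column k k≤3 = k , ℕₚ.≤-trans (s≤s k≤3) 4≤N , refl

  IsSign : ℤ → Set
  IsSign e = (e ≡ 1ℤ) ⊎ (e ≡ - 1ℤ)

  -- The width 12p leaves room for six steps of length p on at least one side of every column.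
  side : ∀ {n} → Column N n →
         Σ[ e ∈ ℤ ] IsSign e × (∀ s → s ℕ.≤ 6 → Column N (n + e * + s * π))
  side (k , k<N , refl) with k ℕ.+ 6 ℕ.* p ℕ.<? N
  ... | yes far = 1ℤ , inj₁ refl , λ s s≤6 →
          k ℕ.+ s ℕ.* p , ℕₚ.≤-<-trans (ℕₚ.+-monoʳ-≤ k (ℕₚ.*-monoˡ-≤ p s≤6)) far ,
          trans (eq (+ k) (+ s) π) (cong (λ z → + k + z) (sym (ℤₚ.pos-* s p)))
    where
    eq : ∀ k s q → k + 1ℤ * s * q ≡ k + s * q
    eq = solve-∀
  ... | no ¬far = - 1ℤ , inj₂ refl , λ s s≤6 →
          k ℕ.∸ s ℕ.* p , ℕₚ.≤-<-trans (ℕₚ.m∸n≤m k (s ℕ.* p)) k<N , left s s≤6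
    where
    6p≤k : 6 ℕ.* p ℕ.≤ k
    6p≤k = ℕₚ.+-cancelʳ-≤ (6 ℕ.* p) (6 ℕ.* p) k
             (ℕₚ.≤-trans (ℕₚ.≤-reflexive (sym (ℕₚ.*-distribʳ-+ p 6 6)))
               (ℕₚ.≤-trans wide (ℕₚ.≮⇒≥ ¬far)))
    eq : ∀ k s q → (k + s * q) + (- 1ℤ) * s * q ≡ k
    eq = solve-∀
    left : ∀ s → s ℕ.≤ 6 → + k + (- 1ℤ) * + s * π ≡ + (k ℕ.∸ s ℕ.* p)
    left s s≤6 = trans (cong (_+ (- 1ℤ) * + s * π)
                   (trans (cong +_ (sym (ℕₚ.m∸n+n≡m (ℕₚ.≤-trans (ℕₚ.*-monoˡ-≤ p s≤6) 6p≤k))))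
                          (cong (λ z → + (k ℕ.∸ s ℕ.* p) + z) (ℤₚ.pos-* s p))))
                   (eq (+ (k ℕ.∸ s ℕ.* p)) (+ s) π)

  null-sign* : ∀ {e} → IsSign e → ∀ x → Null (e * x) → Null x
  null-sign* (inj₁ refl) x n = null-lin₁ 1ℤ n (eq x)
    where
    eq : ∀ x → x ≡ 1ℤ * (1ℤ * x)
    eq = solve-∀
  null-sign* (inj₂ refl) x n = null-lin₁ (- 1ℤ) n (eq x)
    where
    eq : ∀ x → x ≡ (- 1ℤ) * ((- 1ℤ) * x)
    eq = solve-∀

  -- `proper` records that the common powers of p are removed; with A = B = 0 the condition `reads`
  -- would hold vacuously.
  record Reading (G : ℤ → ℤ → ℤ) (j i A B : ℤ) : Set where
    field
      proper : ¬ (Null A × Null B)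
      reads  : ∀ {n} → Column N n → Reads (G n (j * n + i)) (A * n + B)

  Lined : (ℤ → ℤ → ℤ) → Set
  Lined G = ∀ j i → Σ[ A ∈ ℤ ] Σ[ B ∈ ℤ ] Reading G j i A B

  Normal : (ℤ → ℤ → ℤ) → Set
  Normal G = ∀ {n} → Column N n → ∀ y → ¬ Null y → Null (G n y - y)

  -- If the conclusion fails, the functions j n + i, A n + B and their difference are all isolated
  -- modulo p, so one of the columns 0 to 3 avoids the zeros of all three. The cell there is
  -- congruent to both j n + i and A n + B, a contradiction.
  normal-reading : ∀ {G j i A B} → Normal G → Reading G j i A B → ¬ (Null j × Null i) →
                   Null (A - j) × Null (B - i)
  normal-reading {G} {j} {i} {A} {B} norm rd ¬ji
    with null? (A - j) ×-dec null? (B - i)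
  ... | yes both = both
  ... | no ¬both with avoid₃ (λ s → null? (j * + s + i)) (λ s → null? (A * + s + B))
                             (λ s → null? ((A - j) * + s + (B - i)))
                             (affine-isolated ¬ji) (affine-isolated (Reading.proper rd))
                             (affine-isolated ¬both) 0
  ...   | d , d≤3 , ¬x , ¬X , ¬diff = ⊥-elim (¬diff
          (null-lin₂ 1ℤ (- 1ℤ) (norm col _ ¬x) (proj₁ (Reading.reads rd col) ¬X)
                     (eq A B j i (+ (d ℕ.+ 0)) (G (+ (d ℕ.+ 0)) (j * + (d ℕ.+ 0) + i)))))
    where
    col : Column N (+ (d ℕ.+ 0))
    col = small-column (d ℕ.+ 0) (subst (ℕ._≤ 3) (sym (ℕₚ.+-identityʳ d)) d≤3)
    eq : ∀ A B j i s g → (A - j) * s + (B - i) ≡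
         1ℤ * (g - (j * s + i)) + (- 1ℤ) * (g - (A * s + B))
    eq = solve-∀

  affine-mod : ∀ (f : ℤ → ℤ) a → (∀ y → Null (f (y + 1ℤ) - (f y + a))) →
               ∀ y → Null (f y - (a * y + f 0ℤ))
  affine-mod f a step (+ zero) = divides 0ℤ (eq a (f 0ℤ))
    where
    eq : ∀ a z → z - (a * 0ℤ + z) ≡ 0ℤ
    eq = solve-∀
  affine-mod f a step (+ suc k) =
    null-lin₂ 1ℤ 1ℤ (subst (λ z → Null (f z - (f (+ k) + a))) (ℤₚ.+-comm (+ k) 1ℤ) (step (+ k)))
              (affine-mod f a step (+ k)) (eq a (f (+ suc k)) (f (+ k)) (f 0ℤ) (+ k))
    where
    eq : ∀ a z z′ o k → z - (a * (1ℤ + k) + o) ≡ 1ℤ * (z - (z′ + a)) + 1ℤ * (z′ - (a * k + o))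
    eq = solve-∀
  affine-mod f a step -[1+ k ] =
    null-lin₂ (- 1ℤ) 1ℤ (step -[1+ k ]) (prev k)
              (eq a (f -[1+ k ]) (f (-[1+ k ] + 1ℤ)) (f 0ℤ) -[1+ k ])
    where
    eq : ∀ a z z′ o k → z - (a * k + o) ≡ (- 1ℤ) * (z′ - (z + a)) + 1ℤ * (z′ - (a * (k + 1ℤ) + o))
    eq = solve-∀
    prev : ∀ k → Null (f (-[1+ k ] + 1ℤ) - (a * (-[1+ k ] + 1ℤ) + f 0ℤ))
    prev zero    = affine-mod f a step 0ℤ
    prev (suc k) = affine-mod f a step -[1+ k ]

  -- Here a and b are the digits of the first and the second line at the vertices where the third
  -- line meets them, and f, f′ are the digits of the third line there. Both a and b are units, but
  -- a vanishing f or f′ is not tied to them, whence four cases; they contradict the hypotheses on t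
  -- (2J - J′), c′ + 2 t J, t J′ and c′ in turn.
  triangle-clash : ∀ {J J′ t c c′ a b f f′} → Null c → ¬ Null c′ →
    ¬ Null (t * J) → ¬ Null (t * J′) → ¬ Null (t * (+ 2 * J - J′)) →
    ¬ Null (c′ + t * J′) → ¬ Null (c′ + + 2 * (t * J)) →
    Null (a - (c + + 2 * t * J)) → Null (b - (c′ + t * J′)) →
    Null (f′ - (f + (- t) * (+ 2 * J - J′))) →
    (¬ Null f → ¬ Null a → Null (f - a)) → (¬ Null f′ → ¬ Null b → Null (f′ - b)) → ⊥
  triangle-clash {J} {J′} {t} {c} {c′} {a} {b} {f} {f′} nc ¬c′ ¬J ¬J′ ¬K ¬t₁ ¬t₂ hA hB hF f≡a f′≡b =
    contradict (null? f) (null? f′)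
    where
    ¬a : ¬ Null a
    ¬a na = ¬J (null-2* (t * J) (null-lin₃ 1ℤ (- 1ℤ) (- 1ℤ) na hA nc (eq a c t J)))
      where
      eq : ∀ a c t J → + 2 * (t * J) ≡ 1ℤ * a + (- 1ℤ) * (a - (c + + 2 * t * J)) + (- 1ℤ) * c
      eq = solve-∀

    ¬b : ¬ Null b
    ¬b nb = ¬t₁ (null-cong′ hB nb)

    contradict : Dec (Null f) → Dec (Null f′) → ⊥
    contradict (yes nf) (yes nf′) = ¬K (null-lin₃ (- 1ℤ) 1ℤ 1ℤ nf′ hF nf (eq f f′ t (+ 2 * J - J′)))
      where
      eq : ∀ f f′ t K → t * K ≡ (- 1ℤ) * f′ + 1ℤ * (f′ - (f + (- t) * K)) + 1ℤ * f
      eq = solve-∀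
    contradict (yes nf) (no ¬f′) = ¬t₂
        (null-lin₂ (- 1ℤ) (- 1ℤ) (null-lin₃ 1ℤ (- 1ℤ) (- 1ℤ) (f′≡b ¬f′ ¬b) hF nf refl) hB (eq f f′ b c′ t J J′))
      where
      eq : ∀ f f′ b c′ t J J′ → c′ + + 2 * (t * J) ≡
           (- 1ℤ) * (1ℤ * (f′ - b) + (- 1ℤ) * (f′ - (f + (- t) * (+ 2 * J - J′))) + (- 1ℤ) * f)
           + (- 1ℤ) * (b - (c′ + t * J′))
      eq = solve-∀
    contradict (no ¬f) (yes nf′) = ¬J′
        (null-lin₂ 1ℤ 1ℤ (null-lin₃ 1ℤ (- 1ℤ) (- 1ℤ) nf′ hF (f≡a ¬f ¬a) refl)
                         (null-lin₂ (- 1ℤ) (- 1ℤ) hA nc refl) (eq f f′ a c t J J′))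
      where
      eq : ∀ f f′ a c t J J′ → t * J′ ≡
           1ℤ * (1ℤ * f′ + (- 1ℤ) * (f′ - (f + (- t) * (+ 2 * J - J′))) + (- 1ℤ) * (f - a))
           + 1ℤ * ((- 1ℤ) * (a - (c + + 2 * t * J)) + (- 1ℤ) * c)
      eq = solve-∀
    contradict (no ¬f) (no ¬f′) = ¬c′
        (null-lin₂ 1ℤ 1ℤ (null-lin₃ (- 1ℤ) 1ℤ 1ℤ (f′≡b ¬f′ ¬b) hF (f≡a ¬f ¬a) refl)
                         (null-lin₃ 1ℤ 1ℤ (- 1ℤ) hA nc hB refl) (eq f f′ a b c c′ t J J′))
      where
      eq : ∀ f f′ a b c c′ t J J′ → c′ ≡
           1ℤ * ((- 1ℤ) * (f′ - b) + 1ℤ * (f′ - (f + (- t) * (+ 2 * J - J′))) + 1ℤ * (f - a))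
           + 1ℤ * (1ℤ * (a - (c + + 2 * t * J)) + 1ℤ * c + (- 1ℤ) * (b - (c′ + t * J′)))
      eq = solve-∀

  -- The next digits of the multiples of p on a normal board.

  module _ {G : ℤ → ℤ → ℤ} (lined : Lined G) (norm : Normal G) where

    -- Some line of slope J through the point (n, y p) assigns to it the next digit c.
    record Through (J n y c : ℤ) : Set where
      field
        {i A B} : ℤ
        reading : Reading G J i A B
        point   : J * n + i ≡ y * π
        value   : A * n + B ≡ c * π

    -- By `normal-reading`, A n + B is congruent to J n + i = y p, so it is a multiple of p, and c
    -- is the quotient.
    through : ∀ {J} → ¬ Null J → ∀ n y → Σ[ c ∈ ℤ ] Through J n y c
    through {J} ¬J n y with lined J (y * π - J * n)
    ... | A , B , rd with normal-reading norm rd (λ (nJ , _) → ¬J nJ)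
    ...   | nA , nB with null-lin₃ n 1ℤ y nA nB (divides 1ℤ (sym (ℤₚ.*-identityˡ π)))
                         (eq A B J n y π)
      where
      eq : ∀ A B J n y q → A * n + B ≡ n * (A - J) + 1ℤ * (B - (y * q - J * n)) + y * q
      eq = solve-∀
    ...     | divides c value = c , record { reading = rd ; point = eq J n (y * π) ; value = value }
      where
      eq : ∀ J n z → J * n + (z - J * n) ≡ z
      eq = solve-∀

    -- Moving t p columns along the line adds t J to y and t A to the digit, and A ≡ J by
    -- `normal-reading`.
    shift : ∀ {J n y c} → ¬ Null J → Through J n y c → ∀ t →
            Σ[ c′ ∈ ℤ ] Through J (n + t * π) (y + t * J) c′ × Null (c′ - (c + t * J))
    shift {J} {n} {y} {c} ¬J th t = c + t * A
      , record { reading = reading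
               ; point = trans (eq J n t π i) (trans (cong (_+ t * J * π) point) (eq′ y t J π))
               ; value = trans (eq A n t π B) (trans (cong (_+ t * A * π) value) (eq′ c t A π)) }
      , null-lin₁ t (proj₁ (normal-reading norm reading (λ (nJ , _) → ¬J nJ))) (eq″ c t A J)
      where
      open Through th
      eq : ∀ J n t q i → J * (n + t * q) + i ≡ (J * n + i) + t * J * q
      eq = solve-∀
      eq′ : ∀ y t J q → y * q + t * J * q ≡ (y + t * J) * q
      eq′ = solve-∀
      eq″ : ∀ c t A J → (c + t * A) - (c + t * J) ≡ t * (A - J)
      eq″ = solve-∀

    through-reads : ∀ {J n y c} → Through J n y c → Column N n → ¬ Null c → Null (G n (y * π) - c)
    through-reads {n = n} th col ¬c =
      subst (λ z → Null (G n z - _)) point (proj₂ (Reading.reads reading col) _ value ¬c)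
      where open Through th

    through-equal : ∀ {J J′ n y c c′} → Through J n y c → Through J′ n y c′ → Column N n →
                    ¬ Null c → ¬ Null c′ → Null (c - c′)
    through-equal {n = n} {y} {c} {c′} th th′ col ¬c ¬c′ =
      null-lin₂ (- 1ℤ) 1ℤ (through-reads th col ¬c) (through-reads th′ col ¬c′) (eq c c′ (G n (y * π)))
      where
      eq : ∀ c c′ g → c - c′ ≡ (- 1ℤ) * (g - c) + 1ℤ * (g - c′)
      eq = solve-∀

    -- A third line of slope K = 2J − J′ joins a point of the first line to one of the second.
    no-clash : ∀ {J J′ n y c c′} → ¬ Null J → ¬ Null J′ → ¬ Null (+ 2 * J - J′) → Column N n →
               Through J n y c → Through J′ n y c′ → Null c → ¬ Null c′ → ⊥
    no-clash {J} {J′} {n} {y} {c} {c′} ¬J ¬J′ ¬K col th th′ nc ¬c′ =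
      triangle-clash {J} {J′} {t} {c} {c′} {proj₁ A} {proj₁ B} {proj₁ C} {f′} nc ¬c′
        (¬null-t* {J} ¬J) (¬null-t* {J′} ¬J′) (¬null-t* {K} ¬K)
        (λ n → proj₁ (proj₂ (proj₂ choice)) (subst Null (eqJ′ c′ e (+ s) J′) n))
        (λ n → proj₂ (proj₂ (proj₂ choice)) (subst Null (eqJ c′ e (+ s) J) n))
        (proj₂ (proj₂ A)) (proj₂ (proj₂ B)) (proj₂ (proj₂ C′))
        (through-equal (proj₂ C) (proj₁ (proj₂ A)) colA)
        (through-equal thC′ (proj₁ (proj₂ B)) colB)
      where
      eqJ′ : ∀ c′ e s J′ → c′ + e * s * J′ ≡ e * J′ * s + c′
      eqJ′ = solve-∀
      eqJ : ∀ c′ e s J → c′ + + 2 * (e * s * J) ≡ e * (+ 2 * J) * s + c′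
      eqJ = solve-∀
      e = proj₁ (side col)
      sgn = proj₁ (proj₂ (side col))
      ¬eJ′ : ¬ (Null (e * J′) × Null c′)
      ¬eJ′ (_ , n) = ¬c′ n
      ¬e2J : ¬ (Null (e * (+ 2 * J)) × Null c′)
      ¬e2J (_ , n) = ¬c′ n
      -- Starting at 1 gives s in {1, 2, 3}, so s is a unit modulo p and the 2 s steps along the
      -- first line are at most the six that `side` provides. The two values to avoid make the
      -- digits c′ + t J′ and c′ + 2 t J vanish.
      choice = avoid₂ (λ s → null? (e * J′ * + s + c′)) (λ s → null? (e * (+ 2 * J) * + s + c′))
                      (affine-isolated ¬eJ′) (affine-isolated ¬e2J) 1
      d = proj₁ choice
      d≤2 = proj₁ (proj₂ choice)
      s = d ℕ.+ 1
      t = e * + s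
      K = + 2 * J - J′

      s≤3 : s ℕ.≤ 3
      s≤3 = ℕₚ.+-monoˡ-≤ 1 d≤2

      ¬null-t* : ∀ {x} → ¬ Null x → ¬ Null (t * x)
      ¬null-t* {x} ¬x n = ¬x (null-small* d d≤2 x
        (subst (λ k → Null (+ k * x)) (ℕₚ.+-comm d 1)
          (null-sign* sgn (+ s * x) (subst Null (ℤₚ.*-assoc e (+ s) x) n))))

      colA : Column N (n + + 2 * t * π)
      colA = subst (λ z → Column N (n + z * π))
                   (trans (cong (e *_) (ℤₚ.pos-* 2 s)) (eq e (+ s)))
                   (proj₂ (proj₂ (side col)) (2 ℕ.* s) (ℕₚ.*-monoʳ-≤ 2 s≤3))
        where
        eq : ∀ e s → e * (+ 2 * s) ≡ + 2 * (e * s)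
        eq = solve-∀

      colB : Column N (n + t * π)
      colB = proj₂ (proj₂ (side col)) s (ℕₚ.≤-trans s≤3 (ℕₚ.m≤m+n 3 3))

      A = shift ¬J th (+ 2 * t)
      B = shift ¬J′ th′ t
      C = through ¬K (n + + 2 * t * π) (y + + 2 * t * J)
      C′ = shift ¬K (proj₂ C) (- t)
      f′ = proj₁ C′

      thC′ : Through K (n + t * π) (y + t * J′) f′
      thC′ = subst₂ (λ u v → Through K u v f′) (eq n t π) (eq′ y t J J′) (proj₁ (proj₂ C′))
        where
        eq : ∀ n t q → n + + 2 * t * q + (- t) * q ≡ n + t * q
        eq = solve-∀
        eq′ : ∀ y t J J′ → y + + 2 * t * J + (- t) * (+ 2 * J - J′) ≡ y + t * J′
        eq′ = solve-∀

    -- Two nonzero digits are both read from the same cell. A zero digit against a nonzero one is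
    -- excluded by `no-clash`; either line can be the one with the zero, so both third slopes have
    -- to be units.
    agree : ∀ {J J′ n y c c′} → ¬ Null J → ¬ Null J′ →
            ¬ Null (+ 2 * J - J′) → ¬ Null (+ 2 * J′ - J) → Column N n →
            Through J n y c → Through J′ n y c′ → Null (c - c′)
    agree {c = c} {c′} ¬J ¬J′ ¬K ¬K′ col th th′ with null? c | null? c′
    ... | yes nc | yes nc′ = null-− nc nc′
    ... | yes nc | no ¬c′  = ⊥-elim (no-clash ¬J ¬J′ ¬K col th th′ nc ¬c′)
    ... | no ¬c  | yes nc′ = ⊥-elim (no-clash ¬J′ ¬J ¬K′ col th′ th nc′ ¬c)
    ... | no ¬c  | no ¬c′  = through-equal th th′ col ¬c ¬c′

    -- For slopes 2 and 3 the third slopes are 2·2 - 3 = 1 and 2·3 - 2 = 4, both units.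
    agree-with-3 : ∀ {J n y c c′} → Null (J - + 2) → Column N n →
                   Through J n y c → Through (+ 3) n y c′ → Null (c - c′)
    agree-with-3 {J} J≡2 =
      agree (λ n → ¬null-2 (null-cong′ J≡2 n)) ¬null-3
            (λ n → ¬null-1 (null-lin₂ 1ℤ (- + 2) n J≡2 (eq₁ J)))
            (λ n → ¬null-4 (null-lin₂ 1ℤ 1ℤ n J≡2 (eq₂ J)))
      where
      eq₁ : ∀ J → 1ℤ ≡ 1ℤ * (+ 2 * J - + 3) + (- + 2) * (J - + 2)
      eq₁ = solve-∀
      eq₂ : ∀ J → + 4 ≡ 1ℤ * (+ 2 * + 3 - J) + 1ℤ * (J - + 2)
      eq₂ = solve-∀

    -- Read off the line of slope 2; by `digit-through` any line of slope ≡ 2 gives the same value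
    -- modulo p.
    digit : ℤ → ℤ → ℤ
    digit n y = proj₁ (through ¬null-2 n y)

    offset : ℤ → ℤ
    offset n = digit n 0ℤ

    digit-through : ∀ {J n y c} → Null (J - + 2) → Column N n → Through J n y c → Null (c - digit n y)
    digit-through {n = n} {y} {c} J≡2 col th =
      null-lin₂ 1ℤ (- 1ℤ) (agree-with-3 J≡2 col th th₃)
                (agree-with-3 (divides 0ℤ refl) col (proj₂ (through ¬null-2 n y)) th₃)
                (eq c (digit n y) (proj₁ (through ¬null-3 n y)))
      where
      th₃ = proj₂ (through ¬null-3 n y)
      eq : ∀ c c₂ c₃ → c - c₂ ≡ 1ℤ * (c - c₃) + (- 1ℤ) * (c₂ - c₃)
      eq = solve-∀

    -- The line of slope 2 through height y + e and the line of slope 3 through height y (in units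
    -- of p) meet e p columns away, at height y + 3e. Their digits have grown by 2e and 3e, so those
    -- at column n differ by e. The sign e is that of a side on which column n + e p is on the
    -- board; for e = - 1 the relation is used at y + 1.
    digit-suc : ∀ {n} → Column N n → ∀ y → Null (digit n (y + 1ℤ) - (digit n y + 1ℤ))
    digit-suc {n} col y = forward sgn
      where
      e = proj₁ (side col)
      sgn = proj₁ (proj₂ (side col))
      col′ : Column N (n + e * π)
      col′ = subst (λ z → Column N (n + z * π)) (ℤₚ.*-identityʳ e) (proj₂ (proj₂ (side col)) 1 (s≤s z≤n))

      move : ∀ y → Null (digit n (y + e) - (digit n y + e))
      move y = null-lin₂ 1ℤ 1ℤ
          (null-lin₂ (- 1ℤ) 1ℤ (proj₂ (proj₂ S₂))
            (agree-with-3 (divides 0ℤ refl) col′ (proj₁ (proj₂ S₂)) th₃′) refl)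
          (null-lin₂ 1ℤ (- 1ℤ) (proj₂ (proj₂ S₃))
            (agree-with-3 (divides 0ℤ refl) col (proj₂ (through ¬null-2 n y)) (proj₂ T₃)) refl)
          (eq (digit n (y + e)) (digit n y) e (proj₁ S₂) (proj₁ S₃) (proj₁ T₃))
        where
        T₃ = through ¬null-3 n y
        S₃ = shift ¬null-3 (proj₂ T₃) e
        S₂ = shift ¬null-2 (proj₂ (through ¬null-2 n (y + e))) e
        eq′ : ∀ y e → y + e * + 3 ≡ y + e + e * + 2
        eq′ = solve-∀
        th₃′ : Through (+ 3) (n + e * π) (y + e + e * + 2) (proj₁ S₃)
        th₃′ = subst (λ v → Through (+ 3) (n + e * π) v (proj₁ S₃)) (eq′ y e) (proj₁ (proj₂ S₃))
        eq : ∀ d′ d e s₂ s₃ t₃ → d′ - (d + e) ≡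
             1ℤ * ((- 1ℤ) * (s₂ - (d′ + e * + 2)) + 1ℤ * (s₂ - s₃))
             + 1ℤ * (1ℤ * (s₃ - (t₃ + e * + 3)) + (- 1ℤ) * (d - t₃))
        eq = solve-∀

      forward : IsSign e → Null (digit n (y + 1ℤ) - (digit n y + 1ℤ))
      forward (inj₁ e≡1) = subst (λ e → Null (digit n (y + e) - (digit n y + e))) e≡1 (move y)
      forward (inj₂ e≡-1) = null-lin₁ (- 1ℤ)
        (subst (λ v → Null (digit n v - (digit n (y + 1ℤ) + - 1ℤ))) (eq y)
          (subst (λ e → Null (digit n (y + 1ℤ + e) - (digit n (y + 1ℤ) + e))) e≡-1 (move (y + 1ℤ))))
        (eq′ (digit n (y + 1ℤ)) (digit n y))
        where
        eq : ∀ y → y + 1ℤ + - 1ℤ ≡ y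
        eq = solve-∀
        eq′ : ∀ d′ d → d′ - (d + 1ℤ) ≡ (- 1ℤ) * (d - (d′ + - 1ℤ))
        eq′ = solve-∀

    digit-affine : ∀ {n} → Column N n → ∀ y → Null (digit n y - (y + offset n))
    digit-affine {n} col y =
      subst (λ z → Null (digit n y - (z + offset n))) (ℤₚ.*-identityˡ y)
            (affine-mod (digit n) 1ℤ (digit-suc col) y)

    -- The multiples of p, indexed by y, thus form a board that is normal up to one offset per
    -- column.
    multiples-read : ∀ {n} → Column N n → ∀ y → ¬ Null (y + offset n) →
                     Null (G n (y * π) - (y + offset n))
    multiples-read {n} col y ¬c =
      null-lin₂ 1ℤ 1ℤ
        (through-reads (proj₂ (through ¬null-2 n y)) col (λ nd → ¬c (null-cong′ (digit-affine col y) nd)))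
        (digit-affine col y) (eq (G n (y * π)) (digit n y) (y + offset n))
      where
      eq : ∀ g d z → g - z ≡ 1ℤ * (g - d) + 1ℤ * (d - z)
      eq = solve-∀

-- Affine offsets and the passage from one p-adic level to the next.

module Levels (M : Modulus) (N : ℕ) (wide : 12 ℕ.* Modulus.p M ℕ.≤ N) where
  open Residues M
  open Boards M N wide

  -- Three terms in arithmetic progression are each 0 or the prescribed - δ, δ, 4δ. If the first two
  -- are 0, then so are w and A; in all other cases the second difference is ± δ, ± 2δ or ± 3δ,
  -- which is not 0 modulo p.
  no-bend : ∀ {δ A w} → ¬ Null δ → ¬ (Null A × Null w) →
            Null w ⊎ Null (w - - δ) → Null (w + A) ⊎ Null (w + A - δ) →
            Null (w + + 2 * A) ⊎ Null (w + + 2 * A - + 4 * δ) → ⊥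
  no-bend {δ} {A} {w} ¬δ ¬Aw (inj₁ x) (inj₁ y) _ = ¬Aw (null-lin₂ 1ℤ (- 1ℤ) y x (eq A w) , x)
    where
    eq : ∀ A w → A ≡ 1ℤ * (w + A) + (- 1ℤ) * w
    eq = solve-∀
  no-bend {δ} {A} {w} ¬δ _ (inj₁ x) (inj₂ y) (inj₁ z) =
    ¬δ (null-2* δ (null-lin₃ 1ℤ (- + 2) 1ℤ x y z (eq A w δ)))
    where
    eq : ∀ A w δ → + 2 * δ ≡ 1ℤ * w + (- + 2) * (w + A - δ) + 1ℤ * (w + + 2 * A)
    eq = solve-∀
  no-bend {δ} {A} {w} ¬δ _ (inj₁ x) (inj₂ y) (inj₂ z) =
    ¬δ (null-2* δ (null-lin₃ (- 1ℤ) (+ 2) (- 1ℤ) x y z (eq A w δ)))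
    where
    eq : ∀ A w δ → + 2 * δ ≡ (- 1ℤ) * w + + 2 * (w + A - δ) + (- 1ℤ) * (w + + 2 * A - + 4 * δ)
    eq = solve-∀
  no-bend {δ} {A} {w} ¬δ _ (inj₂ x) (inj₁ y) (inj₁ z) =
    ¬δ (null-lin₃ 1ℤ (- + 2) 1ℤ x y z (eq A w δ))
    where
    eq : ∀ A w δ → δ ≡ 1ℤ * (w - - δ) + (- + 2) * (w + A) + 1ℤ * (w + + 2 * A)
    eq = solve-∀
  no-bend {δ} {A} {w} ¬δ _ (inj₂ x) (inj₁ y) (inj₂ z) =
    ¬δ (null-3* δ (null-lin₃ (- 1ℤ) (+ 2) (- 1ℤ) x y z (eq A w δ)))
    where
    eq : ∀ A w δ → + 3 * δ ≡ (- 1ℤ) * (w - - δ) + + 2 * (w + A) + (- 1ℤ) * (w + + 2 * A - + 4 * δ)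
    eq = solve-∀
  no-bend {δ} {A} {w} ¬δ _ (inj₂ x) (inj₂ y) (inj₁ z) =
    ¬δ (null-3* δ (null-lin₃ 1ℤ (- + 2) 1ℤ x y z (eq A w δ)))
    where
    eq : ∀ A w δ → + 3 * δ ≡ 1ℤ * (w - - δ) + (- + 2) * (w + A - δ) + 1ℤ * (w + + 2 * A)
    eq = solve-∀
  no-bend {δ} {A} {w} ¬δ _ (inj₂ x) (inj₂ y) (inj₂ z) =
    ¬δ (null-lin₃ (- 1ℤ) (+ 2) (- 1ℤ) x y z (eq A w δ))
    where
    eq : ∀ A w δ → δ ≡ (- 1ℤ) * (w - - δ) + + 2 * (w + A - δ) + (- 1ℤ) * (w + + 2 * A - + 4 * δ)
    eq = solve-∀

  affine-from-differences : ∀ (f : ℕ → ℤ) →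
    (∀ k → 2 ℕ.+ k ℕ.< N → Null (f k - + 2 * f (1 ℕ.+ k) + f (2 ℕ.+ k))) →
    ∀ k → k ℕ.< N → Null (f k - (f 0 + + k * (f 1 - f 0)))
  affine-from-differences f flat zero _ = divides 0ℤ (eq (f 0) (f 1))
    where
    eq : ∀ a b → a - (a + 0ℤ * (b - a)) ≡ 0ℤ
    eq = solve-∀
  affine-from-differences f flat (suc zero) _ = divides 0ℤ (eq (f 0) (f 1))
    where
    eq : ∀ a b → b - (a + 1ℤ * (b - a)) ≡ 0ℤ
    eq = solve-∀
  affine-from-differences f flat (suc (suc k)) k< =
    null-lin₃ 1ℤ (+ 2) (- 1ℤ) (flat k k<)
      (affine-from-differences f flat (suc k) (ℕₚ.<-trans (ℕₚ.n<1+n _) k<))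
      (affine-from-differences f flat k (ℕₚ.<-trans (ℕₚ.n<1+n _) (ℕₚ.<-trans (ℕₚ.n<1+n _) k<)))
      (eq (f 0) (f 1) (f k) (f (suc k)) (f (suc (suc k))) (+ k))
    where
    eq : ∀ a b x y z k → z - (a + (+ 2 + k) * (b - a)) ≡
         1ℤ * (x - + 2 * y + z) + + 2 * (y - (a + (1ℤ + k) * (b - a))) + (- 1ℤ) * (x - (a + k * (b - a)))
    eq = solve-∀

  module _ {G : ℤ → ℤ → ℤ} (lined : Lined G) (norm : Normal G) where

    -- If the second difference δ of the offsets at n, n+1, n+2 were nonzero, the line of
    -- multiples of p meeting these columns in digits −δ, δ, 4δ would have no reading.
    offset-flat : ∀ {n} → Column N n → Column N (n + 1ℤ) → Column N (n + + 2) →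
      Null (offset lined norm n - + 2 * offset lined norm (n + 1ℤ) + offset lined norm (n + + 2))
    offset-flat {n} col₀ col₁ col₂ = conclude (null? δ)
      where
      γ₀ = offset lined norm n
      γ₁ = offset lined norm (n + 1ℤ)
      γ₂ = offset lined norm (n + + 2)
      δ = γ₀ - + 2 * γ₁ + γ₂
      -- j and i are solved from the digits - δ and δ in the first two columns. The third digit is
      -- then 4δ, because the digits along the line have second difference δ.
      j = + 2 * δ + γ₀ - γ₁
      i = - δ - γ₀ - j * n
      L = lined (j * π) (i * π)
      A = proj₁ L
      B = proj₁ (proj₂ L)
      rd = proj₂ (proj₂ L)

      dichotomy : ∀ {n u X} → Column N n → j * n + i + offset lined norm n ≡ u →
                  A * n + B ≡ X → ¬ Null u → Null X ⊎ Null (X - u)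
      dichotomy {n} {u} {X} col refl refl ¬u = split (null? X)
        where
        eq : ∀ j n i q → j * q * n + i * q ≡ (j * n + i) * q
        eq = solve-∀
        eq′ : ∀ g u X → X - u ≡ 1ℤ * (g - u) + (- 1ℤ) * (g - X)
        eq′ = solve-∀
        g = G n ((j * n + i) * π)
        split : Dec (Null X) → Null X ⊎ Null (X - u)
        split (yes nX) = inj₁ nX
        split (no ¬X) = inj₂ (null-lin₂ 1ℤ (- 1ℤ)
          (multiples-read lined norm col (j * n + i) ¬u)
          (subst (λ z → Null (G n z - X)) (eq j n i π) (proj₁ (Reading.reads rd col) ¬X))
          (eq′ g u X))

      conclude : Dec (Null δ) → Null δ
      conclude (yes nδ) = nδ
      conclude (no ¬δ) = ⊥-elim (no-bend ¬δ
          (λ (nA , nw) → Reading.proper rd (nA , null-lin₂ 1ℤ (- n) nw nA (eqB A B n)))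
          (dichotomy col₀ (eq₀ γ₀ γ₁ γ₂ n) refl (λ nd → ¬δ (null-lin₁ (- 1ℤ) nd (eq- δ))))
          (dichotomy col₁ (eq₁ γ₀ γ₁ γ₂ n) (eqX₁ A B n) ¬δ)
          (dichotomy col₂ (eq₂ γ₀ γ₁ γ₂ n) (eqX₂ A B n)
            (λ nd → ¬δ (null-2* δ (null-2* (+ 2 * δ) (subst Null (eq4 δ) nd))))))
        where
        eqB : ∀ A B n → B ≡ 1ℤ * (A * n + B) + (- n) * A
        eqB = solve-∀
        eq- : ∀ δ → δ ≡ (- 1ℤ) * (- δ)
        eq- = solve-∀
        eq4 : ∀ δ → + 4 * δ ≡ + 2 * (+ 2 * δ)
        eq4 = solve-∀
        eqX₁ : ∀ A B n → A * (n + 1ℤ) + B ≡ A * n + B + A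
        eqX₁ = solve-∀
        eqX₂ : ∀ A B n → A * (n + + 2) + B ≡ A * n + B + + 2 * A
        eqX₂ = solve-∀
        eq₀ : ∀ a b c n → let δ = a - + 2 * b + c ; j = + 2 * δ + a - b in
              j * n + (- δ - a - j * n) + a ≡ - δ
        eq₀ = solve-∀
        eq₁ : ∀ a b c n → let δ = a - + 2 * b + c ; j = + 2 * δ + a - b in
              j * (n + 1ℤ) + (- δ - a - j * n) + b ≡ δ
        eq₁ = solve-∀
        eq₂ : ∀ a b c n → let δ = a - + 2 * b + c ; j = + 2 * δ + a - b in
              j * (n + + 2) + (- δ - a - j * n) + c ≡ + 4 * δ
        eq₂ = solve-∀

    offset-slope : ℤ
    offset-slope = offset lined norm 1ℤ - offset lined norm 0ℤ

    offset-affine : ∀ {n} → Column N n →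
      Null (offset lined norm n - (offset lined norm 0ℤ + n * offset-slope))
    offset-affine (k , k<N , refl) =
      affine-from-differences (λ k → offset lined norm (+ k)) flat k k<N
      where
      flat : ∀ k → 2 ℕ.+ k ℕ.< N →
             Null (offset lined norm (+ k) - + 2 * offset lined norm (+ (1 ℕ.+ k)) + offset lined norm (+ (2 ℕ.+ k)))
      flat k k< = subst₂ (λ u v → Null (offset lined norm (+ k) - + 2 * offset lined norm u + offset lined norm v))
        (ℤₚ.+-comm (+ k) 1ℤ) (ℤₚ.+-comm (+ k) (+ 2))
        (offset-flat (k , ℕₚ.<-trans (ℕₚ.n<1+n _) (ℕₚ.<-trans (ℕₚ.n<1+n _) k<) , refl)
                     (1 ℕ.+ k , ℕₚ.<-trans (ℕₚ.n<1+n _) k< , ℤₚ.+-comm (+ k) 1ℤ)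
                     (2 ℕ.+ k , k< , ℤₚ.+-comm (+ k) (+ 2)))

  -- The rows of step Q above the reference line J n + I. A line (u, v) of this sub-board is the
  -- line (J + Q u, I + Q v) of the board, so readings carry over.
  embed : (ℤ → ℤ → ℤ) → ℤ → ℤ → ℤ → ℤ → ℤ → ℤ
  embed ρ J I Q n y = ρ n (J * n + I + Q * y)

  reading-embed : ∀ {ρ u v A B} J I Q → Reading ρ (J + Q * u) (I + Q * v) A B →
                  Reading (embed ρ J I Q) u v A B
  reading-embed {ρ} {u} {v} {A} {B} J I Q rd = record
    { proper = Reading.proper rd
    ; reads = λ {n} col → subst (λ z → Reads (ρ n z) (A * n + B)) (eq J I Q u v n) (Reading.reads rd col) }
    where
    eq : ∀ J I Q u v n → (J + Q * u) * n + (I + Q * v) ≡ J * n + I + Q * (u * n + v)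
    eq = solve-∀

  lined-embed : ∀ {ρ} J I Q → Lined ρ → Lined (embed ρ J I Q)
  lined-embed J I Q lined u v with lined (J + Q * u) (I + Q * v)
  ... | A , B , rd = A , B , reading-embed J I Q rd

  -- Level a consists of the points whose height above the line J n + I is a multiple of p to the
  -- power a.
  record Level (ρ : ℤ → ℤ → ℤ) (a : ℕ) : Set where
    field
      J I    : ℤ
      normal : Normal (embed ρ J I (π ^ a))

  level-reading : ∀ {ρ a u v A B} (L : Level ρ a) → let open Level L in
    Reading ρ (J + π ^ a * u) (I + π ^ a * v) A B → ¬ (Null u × Null v) → Null (A - u) × Null (B - v)
  level-reading {ρ} {a} {u} {v} L rd =
    normal-reading normal (reading-embed {ρ} {u} {v} J I (π ^ a) rd)
    where open Level L

  module _ {ρ : ℤ → ℤ → ℤ} (lined : Lined ρ) {a : ℕ} (L : Level ρ a) where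
    open Level L

    private
      Q = π ^ a
      G = embed ρ J I Q
      linedG : Lined G
      linedG = lined-embed J I Q lined
      j₀ = - offset-slope linedG normal
      i₀ = - offset linedG normal 0ℤ

      recenter : ∀ {n} → Column N n → ∀ y → Null (y + j₀ * n + i₀ + offset linedG normal n - y)
      recenter {n} col y = null-lin₁ 1ℤ (offset-affine linedG normal col)
        (eq y (offset-slope linedG normal) (offset linedG normal 0ℤ) n (offset linedG normal n))
        where
        eq : ∀ y s o n γ → y + (- s) * n + (- o) + γ - y ≡ 1ℤ * (γ - (o + n * s))
        eq = solve-∀

    -- The offsets are affine in n, so replacing y by y + j₀ n + i₀ cancels them: the multiple of p
    -- at that place shows y itself.
    next : Level ρ (suc a)
    next = record
      { J = J + Q * (j₀ * π)
      ; I = I + Q * (i₀ * π)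
      ; normal = λ {n} col y ¬y → subst (λ z → Null (ρ n z - y)) (eq J I Q j₀ i₀ n y π)
          (null-lin₂ 1ℤ 1ℤ
            (multiples-read linedG normal col (y + j₀ * n + i₀) (λ nz → ¬y (null-cong′ (recenter col y) nz)))
            (recenter col y)
            (eq′ (G n ((y + j₀ * n + i₀) * π)) (y + j₀ * n + i₀ + offset linedG normal n) y))
      }
      where
      eq : ∀ J I Q j i n y q → J * n + I + Q * ((y + j * n + i) * q) ≡
           (J + Q * (j * q)) * n + (I + Q * (i * q)) + q * Q * y
      eq = solve-∀
      eq′ : ∀ g z y → g - y ≡ 1ℤ * (g - z) + 1ℤ * (z - y)
      eq′ = solve-∀

    -- Seen from level a, the point of level a + 1 at y in column 0 has height v = (y + i₀) p. On a
    -- line of slope u ≡ 2 through it, B ≡ v ≡ 0, and the quotient B / p is the next digit,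
    -- congruent to y. For a unit y the point is therefore exactly one level up on that line.
    next-point : ∀ y → Σ[ v ∈ ℤ ] Null v × Level.I next + π ^ suc a * y ≡ I + Q * v ×
      (∀ {u A B} → Null (u - + 2) → Reading ρ (J + Q * u) (I + Q * v) A B → ¬ Null y → Simple B)
    next-point y = (y + i₀) * π , divides (y + i₀) refl , eq I Q i₀ y π , simple
      where
      eq : ∀ I Q i y q → I + Q * (i * q) + q * Q * y ≡ I + Q * ((y + i) * q)
      eq = solve-∀
      simple : ∀ {u A B} → Null (u - + 2) → Reading ρ (J + Q * u) (I + Q * ((y + i₀) * π)) A B →
               ¬ Null y → Simple B
      simple {u} {A} {B} u≡2 rd ¬y = conclude
          (null-cong {B} {(y + i₀) * π}
            (proj₂ (level-reading L rd (λ (nu , _) → ¬null-2 (null-cong′ {u} u≡2 nu)))) (divides (y + i₀) refl))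
        where
        col₀ : Column N 0ℤ
        col₀ = small-column 0 z≤n
        eq₁ : ∀ u v → u * 0ℤ + v ≡ v
        eq₁ = solve-∀
        eq₂ : ∀ y i j → y + i ≡ y + j * 0ℤ + i
        eq₂ = solve-∀
        conclude : Null B → Simple B
        conclude (divides c B≡) = c , B≡ , λ nc → ¬y
            (null-cong′ (recenter col₀ y)
              (subst (λ z → Null (z + offset linedG normal 0ℤ)) (eq₂ y i₀ j₀)
                (null-cong′ (digit-affine linedG normal col₀ (y + i₀))
                  (null-cong′ (digit-through linedG normal u≡2 col₀ through₀) nc))))
          where
          through₀ : Through linedG normal u 0ℤ (y + i₀) c
          through₀ = record
            { reading = reading-embed J I Q rd
            ; point = eq₁ u ((y + i₀) * π)
            ; value = trans (eq₁ A B) B≡ }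

-- Rescaling digits by a unit modulo p.

module Scaling (M : Modulus) (α α′ : ℤ) (inverse : + Modulus.p M ∣ α * α′ - 1ℤ) where
  open Residues M

  null-α* : ∀ x → Null (α * x) → Null x
  null-α* x n = null-lin₂ α′ (- x) n inverse (eq α α′ x)
    where
    eq : ∀ a a′ x → x ≡ a′ * (a * x) + (- x) * (a * a′ - 1ℤ)
    eq = solve-∀

  null-α′* : ∀ x → Null (α′ * x) → Null x
  null-α′* x n = null-lin₂ α (- x) n inverse (eq α α′ x)
    where
    eq : ∀ a a′ x → x ≡ a * (a′ * x) + (- x) * (a * a′ - 1ℤ)
    eq = solve-∀

  unscale : ∀ {X} c → α′ * X ≡ c * π → Σ[ c₀ ∈ ℤ ] X ≡ c₀ * π × c ≡ α′ * c₀
  unscale {X} c αX≡ with null-α′* X (divides c αX≡)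
  ... | divides c₀ X≡ = c₀ , X≡ , ℤₚ.*-cancelʳ-≡ c (α′ * c₀) π {{p-nonZero}}
        (trans (sym αX≡) (trans (cong (α′ *_) X≡) (sym (ℤₚ.*-assoc α′ c₀ π))))

  reads-scale : ∀ {r X} → Reads r X → Reads (α′ * r) (α′ * X)
  reads-scale {r} {X} (rd₀ , rd₁) =
      (λ ¬X → null-lin₁ α′ (rd₀ (λ n → ¬X (null-lin₁ α′ n refl))) (eq α′ r X))
    , (λ c αX≡ → second (unscale c αX≡))
    where
    eq : ∀ a r X → a * r - a * X ≡ a * (r - X)
    eq = solve-∀
    second : ∀ {c} → Σ[ c₀ ∈ ℤ ] X ≡ c₀ * π × c ≡ α′ * c₀ → ¬ Null c → Null (α′ * r - c)
    second (c₀ , X≡ , refl) ¬c =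
      null-lin₁ α′ (rd₁ c₀ X≡ (λ n → ¬c (null-lin₁ α′ n refl))) (eq α′ r c₀)

  simple-unscale : ∀ {X} → Simple (α′ * X) → Simple X
  simple-unscale {X} (c , αX≡ , ¬c) = conclude (unscale c αX≡)
    where
    conclude : Σ[ c₀ ∈ ℤ ] X ≡ c₀ * π × c ≡ α′ * c₀ → Simple X
    conclude (c₀ , X≡ , refl) = c₀ , X≡ , λ n → ¬c (null-lin₁ α′ n refl)

-- Level 0: the residues are affine in both board coordinates.

module BaseLevel (M : Modulus) (N : ℕ) (wide : 12 ℕ.* Modulus.p M ℕ.≤ N) where
  open Residues M
  open Boards M N wide
  open Levels M N wide

  module _ (ε : ℤ → ℤ → ℤ)
           (affine : ∀ j i → Σ[ A ∈ ℤ ] Σ[ B ∈ ℤ ] ∀ {n} → Column N n → Null (ε n (j * n + i) - (A * n + B)))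
           where

    -- The affine rule on three consecutive columns, with the unknown A and B eliminated.
    second-difference : ∀ {n} → Column N n → Column N (n + 1ℤ) → Column N (n + + 2) → ∀ x j →
      Null (ε n x - + 2 * ε (n + 1ℤ) (x + j) + ε (n + + 2) (x + + 2 * j))
    second-difference {n} col₀ col₁ col₂ x j = conclude (affine j (x - j * n))
      where
      eq₀ : ∀ n x j → j * n + (x - j * n) ≡ x
      eq₀ = solve-∀
      eq₁ : ∀ n x j → j * (n + 1ℤ) + (x - j * n) ≡ x + j
      eq₁ = solve-∀
      eq₂ : ∀ n x j → j * (n + + 2) + (x - j * n) ≡ x + + 2 * j
      eq₂ = solve-∀
      eq : ∀ A B n u v w → u - + 2 * v + w ≡
           1ℤ * (u - (A * n + B)) + (- + 2) * (v - (A * (n + 1ℤ) + B)) + 1ℤ * (w - (A * (n + + 2) + B))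
      eq = solve-∀
      conclude : (Σ[ A ∈ ℤ ] Σ[ B ∈ ℤ ] ∀ {m} → Column N m → Null (ε m (j * m + (x - j * n)) - (A * m + B))) →
        Null (ε n x - + 2 * ε (n + 1ℤ) (x + j) + ε (n + + 2) (x + + 2 * j))
      conclude (A , B , h) = null-lin₃ 1ℤ (- + 2) 1ℤ
        (subst (λ z → Null (ε n z - (A * n + B))) (eq₀ n x j) (h col₀))
        (subst (λ z → Null (ε (n + 1ℤ) z - (A * (n + 1ℤ) + B))) (eq₁ n x j) (h col₁))
        (subst (λ z → Null (ε (n + + 2) z - (A * (n + + 2) + B))) (eq₂ n x j) (h col₂))
        (eq A B n (ε n x) (ε (n + 1ℤ) (x + j)) (ε (n + + 2) (x + + 2 * j)))

    column-slope : ℤ → ℤ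
    column-slope n = ε n 1ℤ - ε n 0ℤ

    -- The lines from (n, 0) of slope y and from (n, 2) of slope y - 1 meet in column n + 2.
    -- Comparing them, twice the increment of column n + 1 at y is the same for all y.
    column-affine : ∀ {n} → Column N n → Column N (n + 1ℤ) → Column N (n + + 2) → ∀ y →
      Null (ε (n + 1ℤ) y - (column-slope (n + 1ℤ) * y + ε (n + 1ℤ) 0ℤ))
    column-affine {n} col₀ col₁ col₂ = affine-mod f (column-slope (n + 1ℤ)) step
      where
      f : ℤ → ℤ
      f = ε (n + 1ℤ)
      D : ∀ y → Null (+ 2 * (f (y + 1ℤ) - f y) - (ε n (+ 2) - ε n 0ℤ))
      D y = null-lin₂ 1ℤ (- 1ℤ)
        (subst (λ z → Null (ε n 0ℤ - + 2 * f z + ε (n + + 2) (0ℤ + + 2 * y))) (ℤₚ.+-identityˡ y)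
          (second-difference col₀ col₁ col₂ 0ℤ y))
        (subst₂ (λ z z′ → Null (ε n (+ 2) - + 2 * f z + ε (n + + 2) z′)) (eq₁ y) (eq₂ y)
          (second-difference col₀ col₁ col₂ (+ 2) (y - 1ℤ)))
        (eq (f (y + 1ℤ)) (f y) (ε n (+ 2)) (ε n 0ℤ) (ε (n + + 2) (0ℤ + + 2 * y)))
        where
        eq₁ : ∀ y → + 2 + (y - 1ℤ) ≡ y + 1ℤ
        eq₁ = solve-∀
        eq₂ : ∀ y → + 2 + + 2 * (y - 1ℤ) ≡ 0ℤ + + 2 * y
        eq₂ = solve-∀
        eq : ∀ f′ f g′ g h → + 2 * (f′ - f) - (g′ - g) ≡
             1ℤ * (g - + 2 * f + h) + (- 1ℤ) * (g′ - + 2 * f′ + h)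
        eq = solve-∀
      step : ∀ y → Null (f (y + 1ℤ) - (f y + column-slope (n + 1ℤ)))
      step y = null-2* _ (null-lin₂ 1ℤ (- 1ℤ) (D y) (D 0ℤ)
        (eq (f (y + 1ℤ)) (f y) (f 1ℤ) (f 0ℤ) (ε n (+ 2) - ε n 0ℤ)))
        where
        eq : ∀ f′ f f₁ f₀ g → + 2 * (f′ - (f + (f₁ - f₀))) ≡
             1ℤ * (+ 2 * (f′ - f) - g) + (- 1ℤ) * (+ 2 * (f₁ - f₀) - g)
        eq = solve-∀

    private
      c₀ = small-column 0 z≤n
      c₁ = small-column 1 (s≤s z≤n)
      c₂ = small-column 2 (s≤s (s≤s z≤n))
      c₃ = small-column 3 (s≤s (s≤s (s≤s z≤n)))
      α = column-slope 1ℤ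
      α₂ = column-slope (+ 2)
      β = ε (+ 2) 0ℤ - ε 1ℤ 0ℤ
      γ = + 2 * ε 1ℤ 0ℤ - ε (+ 2) 0ℤ

    -- The lines of slopes 1 and 0 from (0, 0) separate by 1 in column 1 and by 2 in column 2;
    -- comparing them gives 2 α ≡ 2 α₂.
    slopes-agree : Null (α₂ - α)
    slopes-agree = null-2* (α₂ - α) (null-lin₃ 1ℤ (- 1ℤ) (- 1ℤ)
      (second-difference c₀ c₁ c₂ 0ℤ 1ℤ) (second-difference c₀ c₁ c₂ 0ℤ 0ℤ)
      (column-affine c₁ c₂ c₃ (+ 2))
      (eq (ε 0ℤ 0ℤ) (ε 1ℤ 0ℤ) (ε 1ℤ 1ℤ) (ε (+ 2) 0ℤ) (ε (+ 2) 1ℤ) (ε (+ 2) (+ 2))))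
      where
      eq : ∀ a b₀ b₁ c₀ c₁ c₂ → + 2 * ((c₁ - c₀) - (b₁ - b₀)) ≡
           1ℤ * (a - + 2 * b₁ + c₂) + (- 1ℤ) * (a - + 2 * b₀ + c₀) + (- 1ℤ) * (c₂ - ((c₁ - c₀) * + 2 + c₀))
      eq = solve-∀

    -- The horizontal line at height m extrapolates column n from columns 1 and 2, which are affine
    -- in m with the same slope.
    plane : ∀ {n} → Column N n → ∀ m → Null (ε n m - (α * m + β * n + γ))
    plane {n} col m = conclude (affine 0ℤ m)
      where
      eq₀ : ∀ n m → 0ℤ * n + m ≡ m
      eq₀ = solve-∀
      conclude : (Σ[ A ∈ ℤ ] Σ[ B ∈ ℤ ] ∀ {n} → Column N n → Null (ε n (0ℤ * n + m) - (A * n + B))) →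
                 Null (ε n m - (α * m + β * n + γ))
      conclude (A , B , h) = null-lin₃ 1ℤ 1ℤ 1ℤ
          (null-lin₃ 1ℤ (n - + 2) (1ℤ - n) (at col) (at c₁) (at c₂) refl)
          (null-lin₂ (+ 2 - n) (n - 1ℤ) (column-affine c₀ c₁ c₂ m) (column-affine c₁ c₂ c₃ m) refl)
          (null-lin₁ ((n - 1ℤ) * m) slopes-agree refl)
          (eq A B n m (ε n m) (ε 1ℤ m) (ε (+ 2) m) α α₂ (ε 1ℤ 0ℤ) (ε (+ 2) 0ℤ))
        where
        at : ∀ {n} → Column N n → Null (ε n m - (A * n + B))
        at {n} col = subst (λ z → Null (ε n z - (A * n + B))) (eq₀ n m) (h col)
        eq : ∀ A B n m e e₁ e₂ α α₂ z₁ z₂ → e - (α * m + (z₂ - z₁) * n + (+ 2 * z₁ - z₂)) ≡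
             1ℤ * (1ℤ * (e - (A * n + B)) + (n - + 2) * (e₁ - (A * 1ℤ + B)) + (1ℤ - n) * (e₂ - (A * + 2 + B)))
             + 1ℤ * ((+ 2 - n) * (e₁ - (α * m + z₁)) + (n - 1ℤ) * (e₂ - (α₂ * m + z₂)))
             + 1ℤ * ((n - 1ℤ) * m * (α₂ - α))
        eq = solve-∀

    slope-invertible : ∀ {m₀ m₁} → ε 1ℤ m₀ ≡ 0ℤ → ε 1ℤ m₁ ≡ 1ℤ → Null (α * (m₁ - m₀) - 1ℤ)
    slope-invertible {m₀} {m₁} e₀ e₁ = null-lin₂ 1ℤ (- 1ℤ)
      (subst (λ e → Null (e - (α * m₀ + β * 1ℤ + γ))) e₀ (plane c₁ m₀))
      (subst (λ e → Null (e - (α * m₁ + β * 1ℤ + γ))) e₁ (plane c₁ m₁))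
      (eq α m₀ m₁ β γ)
      where
      eq : ∀ α m₀ m₁ β γ → α * (m₁ - m₀) - 1ℤ ≡
           1ℤ * (0ℤ - (α * m₀ + β * 1ℤ + γ)) + (- 1ℤ) * (1ℤ - (α * m₁ + β * 1ℤ + γ))
      eq = solve-∀

    -- On the row - α′ (β n + γ) + y the plane takes the value α y modulo p. If y is a unit, the
    -- last nonzero digit is this residue, and multiplying by α′ returns y.
    base-level : ∀ (r : ℤ → ℤ → ℤ) α′ → Null (α * α′ - 1ℤ) →
      (∀ {n} → Column N n → ∀ m → ¬ Null (ε n m) → Null (r n m - ε n m)) →
      Level (λ n m → α′ * r n m) 0
    base-level r α′ inverse top = record
      { J = - (α′ * β)
      ; I = - (α′ * γ)
      ; normal = λ {n} col y ¬y → let m = - (α′ * β) * n + - (α′ * γ) + 1ℤ * y in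
          null-lin₃ α′ α′ (y - α′ * (β * n + γ))
            (top col m (λ ne → ¬y (null-α* y (null-lin₃ 1ℤ (- 1ℤ) (β * n + γ) ne (plane col m) inverse
              (eq₁ α α′ β γ n y (ε n m))))))
            (plane col m) inverse
            (eq₂ α α′ β γ n y (r n m) (ε n m))
      }
      where
      open Scaling M α α′ inverse
      eq₁ : ∀ α α′ β γ n y e → let m = - (α′ * β) * n + - (α′ * γ) + 1ℤ * y in
            α * y ≡ 1ℤ * e + (- 1ℤ) * (e - (α * m + β * n + γ)) + (β * n + γ) * (α * α′ - 1ℤ)
      eq₁ = solve-∀
      eq₂ : ∀ α α′ β γ n y r e → let m = - (α′ * β) * n + - (α′ * γ) + 1ℤ * y in
            α′ * r - y ≡ α′ * (r - e) + α′ * (e - (α * m + β * n + γ)) + (y - α′ * (β * n + γ)) * (α * α′ - 1ℤ)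
      eq₂ = solve-∀

  reading-scale : ∀ {r j i A B α α′} → Null (α * α′ - 1ℤ) → Reading r j i A B →
                  Reading (λ n m → α′ * r n m) j i (α′ * A) (α′ * B)
  reading-scale {r} {j} {i} {A} {B} {α} {α′} inverse rd = record
    { proper = λ (nA , nB) → proper (null-α′* A nA , null-α′* B nB)
    ; reads = λ {n} col → subst (Reads (α′ * r n (j * n + i))) (eq α′ A B n) (reads-scale (reads col)) }
    where
    open Reading rd
    open Scaling M α α′ inverse
    eq : ∀ α′ A B n → α′ * (A * n + B) ≡ α′ * A * n + α′ * B
    eq = solve-∀

-- Neighbouring levels carry domino neighbours.

module DominoStep (M₁ M₂ : Modulus) (N : ℕ)
  (wide₁ : 12 ℕ.* Modulus.p M₁ ℕ.≤ N) (wide₂ : 12 ℕ.* Modulus.p M₂ ℕ.≤ N) where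

  private
    module R₁ = Residues M₁
    module R₂ = Residues M₂
    module B₁ = Boards M₁ N wide₁
    module B₂ = Boards M₂ N wide₂
    module L₁ = Levels M₁ N wide₁
    module L₂ = Levels M₂ N wide₂
  open R₁ using () renaming (π to π₁)
  open R₂ using () renaming (π to π₂)

  -- Only the relation that raises the level of the first prime is kept; exchanging the primes then
  -- yields the other direction from the same argument.
  record HalfLine {W : Set} (ρ₁ ρ₂ : ℤ → ℤ → ℤ) (ω : ℤ → ℤ → W) (R : W → W → Set) (j i : ℤ) : Set where
    field
      {A₁ B₁ A₂ B₂} : ℤ
      {w₀ w₁} : W
      reading₁ : B₁.Reading ρ₁ j i A₁ B₁
      reading₂ : B₂.Reading ρ₂ j i A₂ B₂
      related  : R w₀ w₁
      at₀      : ∀ {n} → Column N n → ¬ R₁.Null (A₁ * n + B₁) → ¬ R₂.Null (A₂ * n + B₂) → ω n (j * n + i) ≡ w₀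
      at₁      : ∀ {n} → Column N n → R₁.Simple (A₁ * n + B₁) → ¬ R₂.Null (A₂ * n + B₂) → ω n (j * n + i) ≡ w₁

  module _ {ρ₁ ρ₂ : ℤ → ℤ → ℤ} {a b : ℕ} (K₁ : L₁.Level ρ₁ a) (K₂ : L₂.Level ρ₂ b) where

    -- A height m in column 0 at level exactly a for p₁ and exactly b for p₂, with both digits
    -- normalised to 1.
    record Point (m : ℤ) : Set where
      field
        y₁ y₂ : ℤ
        m≡₁   : m ≡ L₁.Level.I K₁ + π₁ ^ a * y₁
        m≡₂   : m ≡ L₂.Level.I K₂ + π₂ ^ b * y₂
        y₁≡1  : R₁.Null (y₁ - 1ℤ)
        y₂≡1  : R₂.Null (y₂ - 1ℤ)

  module _ {W : Set} {ρ₁ ρ₂ : ℤ → ℤ → ℤ} {ω : ℤ → ℤ → W} {R : W → W → Set}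
    (lined₁ : B₁.Lined ρ₁) (lines : ∀ j i → HalfLine ρ₁ ρ₂ ω R j i)
    (crt : ∀ a b X Y → Σ[ k ∈ ℤ ] Σ[ l ∈ ℤ ] X + π₁ ^ a * k ≡ Y + π₂ ^ b * l)
    {a b : ℕ} (K₁ : L₁.Level ρ₁ a) (K₂ : L₂.Level ρ₂ b)
    where
    open L₁.Level K₁ using () renaming (J to J₁; I to I₁)
    open L₂.Level K₂ using () renaming (J to J₂; I to I₂)

    private
      col₀ : Column N 0ℤ
      col₀ = B₁.small-column 0 z≤n
      col₁ : Column N 1ℤ
      col₁ = B₁.small-column 1 (s≤s z≤n)

      at-0 : ∀ A B → A * 0ℤ + B ≡ B
      at-0 = solve-∀
      at-1 : ∀ A B → A * 1ℤ + B ≡ A + B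
      at-1 = solve-∀

    -- On the line joining the two cells, both are units for both primes, so both carry the tile w₀
    -- of that line.
    adjacent : ∀ {m} (P : Point K₁ K₂ m) {m′ z₁ z₂} →
      m′ ≡ J₁ + I₁ + π₁ ^ a * z₁ → m′ ≡ J₂ + I₂ + π₂ ^ b * z₂ →
      ¬ R₁.Null z₁ → ¬ R₂.Null z₂ → ω 0ℤ m ≡ ω 1ℤ m′
    adjacent {m} P {m′} {z₁} {z₂} m′≡₁ m′≡₂ ¬z₁ ¬z₂ = conclude (lines (m′ - m) m)
      where
      open Point P
      slope : ∀ {m m′} J I Q y z → m ≡ I + Q * y → m′ ≡ J + I + Q * z → m′ - m ≡ J + Q * (z - y)
      slope J I Q y z refl refl = eq J I Q y z
        where
        eq : ∀ J I Q y z → J + I + Q * z - (I + Q * y) ≡ J + Q * (z - y)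
        eq = solve-∀
      ¬y₁ : ¬ R₁.Null y₁
      ¬y₁ n = R₁.¬null-1 (R₁.null-cong′ y₁≡1 n)
      ¬y₂ : ¬ R₂.Null y₂
      ¬y₂ n = R₂.¬null-1 (R₂.null-cong′ y₂≡1 n)
      eqX : ∀ A B y z → A + B - z ≡ 1ℤ * (A - (z - y)) + 1ℤ * (B - y)
      eqX = solve-∀
      eqm : ∀ m m′ → (m′ - m) * 1ℤ + m ≡ m′
      eqm = solve-∀

      conclude : HalfLine ρ₁ ρ₂ ω R (m′ - m) m → ω 0ℤ m ≡ ω 1ℤ m′
      conclude hl = trans (sym (cong (ω 0ℤ) (at-0 (m′ - m) m)))
          (trans (at₀ col₀ (λ n → ¬y₁ (R₁.null-cong′ (proj₂ near₁) (subst R₁.Null (at-0 A₁ B₁) n)))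
                           (λ n → ¬y₂ (R₂.null-cong′ (proj₂ near₂) (subst R₂.Null (at-0 A₂ B₂) n))))
          (trans (sym (at₀ col₁
                 (λ n → ¬z₁ (R₁.null-cong′ (R₁.null-lin₂ 1ℤ 1ℤ (proj₁ near₁) (proj₂ near₁) (eqX A₁ B₁ y₁ z₁))
                                           (subst R₁.Null (at-1 A₁ B₁) n)))
                 (λ n → ¬z₂ (R₂.null-cong′ (R₂.null-lin₂ 1ℤ 1ℤ (proj₁ near₂) (proj₂ near₂) (eqX A₂ B₂ y₂ z₂))
                                           (subst R₂.Null (at-1 A₂ B₂) n)))))
            (cong (ω 1ℤ) (eqm m m′))))
        where
        open HalfLine hl
        near₁ : R₁.Null (A₁ - (z₁ - y₁)) × R₁.Null (B₁ - y₁)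
        near₁ = L₁.level-reading K₁
          (subst₂ (λ s t → B₁.Reading ρ₁ s t A₁ B₁) (slope J₁ I₁ (π₁ ^ a) y₁ z₁ m≡₁ m′≡₁) m≡₁ reading₁) (λ (_ , n) → ¬y₁ n)
        near₂ : R₂.Null (A₂ - (z₂ - y₂)) × R₂.Null (B₂ - y₂)
        near₂ = L₂.level-reading K₂
          (subst₂ (λ s t → B₂.Reading ρ₂ s t A₂ B₂) (slope J₂ I₂ (π₂ ^ b) y₂ z₂ m≡₂ m′≡₂) m≡₂ reading₂) (λ (_ , n) → ¬y₂ n)

    -- The line from the level-(a+1, b) point in column 0 runs, with slope ≡ 2 at the p₁-level a and
    -- slope ≡ 0 at the p₂-level b, to a level-(a, b) point in column 1.
    horizontal : ∀ {m m′} → Point K₁ K₂ m → Point (L₁.next lined₁ K₁) K₂ m′ → R (ω 0ℤ m) (ω 0ℤ m′)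
    horizontal {m} {m′} P P′ = conclude (crt (suc a) (suc b) (J₁ + π₁ ^ a * + 2) J₂)
                                        (L₁.next-point lined₁ K₁ y₁)
      where
      open Point P′
      ¬y₁ : ¬ R₁.Null y₁
      ¬y₁ n = R₁.¬null-1 (R₁.null-cong′ y₁≡1 n)
      ¬y₂ : ¬ R₂.Null y₂
      ¬y₂ n = R₂.¬null-1 (R₂.null-cong′ y₂≡1 n)
      eq₁ : ∀ J Q q k → J + Q * + 2 + q * Q * k ≡ J + Q * (+ 2 + k * q)
      eq₁ = solve-∀
      eq₂ : ∀ J Q q l → J + q * Q * l ≡ J + Q * (l * q)
      eq₂ = solve-∀
      eq2 : ∀ k q → + 2 + k * q - + 2 ≡ k * q
      eq2 = solve-∀
      along : ∀ {s m} J I Q u v → s ≡ J + Q * u → m ≡ I + Q * v → s * 1ℤ + m ≡ J + I + Q * (u + v)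
      along J I Q u v refl refl = eq J I Q u v
        where
        eq : ∀ J I Q u v → (J + Q * u) * 1ℤ + (I + Q * v) ≡ J + I + Q * (u + v)
        eq = solve-∀
      eqA : ∀ A B u v → A + B - + 2 ≡ 1ℤ * (A - u) + 1ℤ * (B - v) + 1ℤ * (u - + 2 + v)
      eqA = solve-∀
      eqB : ∀ A B u v → A + B - v ≡ 1ℤ * (A - u) + 1ℤ * (B - v) + 1ℤ * u
      eqB = solve-∀
      eqC : ∀ u v → u + v - + 2 ≡ u - + 2 + v
      eqC = solve-∀
      eqD : ∀ u v → u + v - v ≡ 1ℤ * u
      eqD = solve-∀

      conclude : (Σ[ k ∈ ℤ ] Σ[ l ∈ ℤ ] J₁ + π₁ ^ a * + 2 + π₁ ^ suc a * k ≡ J₂ + π₂ ^ suc b * l) →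
        (Σ[ v ∈ ℤ ] R₁.Null v × L₁.Level.I (L₁.next lined₁ K₁) + π₁ ^ suc a * y₁ ≡ I₁ + π₁ ^ a * v ×
          (∀ {u A B} → R₁.Null (u - + 2) → B₁.Reading ρ₁ (J₁ + π₁ ^ a * u) (I₁ + π₁ ^ a * v) A B →
            ¬ R₁.Null y₁ → R₁.Simple B)) →
        R (ω 0ℤ m) (ω 0ℤ m′)
      conclude (k , l , s≡) (v , nv , I′≡ , simple) = subst₂ R (sym ωm≡) (sym ωm′≡) related
        where
        s = J₁ + π₁ ^ a * + 2 + π₁ ^ suc a * k
        u₁ = + 2 + k * π₁
        u₂ = l * π₂
        s≡₁ : s ≡ J₁ + π₁ ^ a * u₁
        s≡₁ = eq₁ J₁ (π₁ ^ a) π₁ k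
        s≡₂ : s ≡ J₂ + π₂ ^ b * u₂
        s≡₂ = trans s≡ (eq₂ J₂ (π₂ ^ b) π₂ l)
        m′≡₁ : m′ ≡ I₁ + π₁ ^ a * v
        m′≡₁ = trans m≡₁ I′≡
        u₁≡2 : R₁.Null (u₁ - + 2)
        u₁≡2 = divides k (eq2 k π₁)
        nu₂ : R₂.Null u₂
        nu₂ = divides l refl
        open HalfLine (lines s m′)

        -- The slope u₁ ≡ 2 is the one for which `next-point` makes m′ a cell of w₁. In column 1 the
        -- coordinates become u₁ + v ≡ 2 and u₂ + y₂ ≡ 1, both units, so the tile there is w₀;
        -- `adjacent` carries it back to m.
        rd₁ : B₁.Reading ρ₁ (J₁ + π₁ ^ a * u₁) (I₁ + π₁ ^ a * v) A₁ B₁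
        rd₁ = subst₂ (λ s t → B₁.Reading ρ₁ s t A₁ B₁) s≡₁ m′≡₁ reading₁
        near₁ : R₁.Null (A₁ - u₁) × R₁.Null (B₁ - v)
        near₁ = L₁.level-reading K₁ rd₁ (λ (n , _) → R₁.¬null-2 (R₁.null-cong′ {u₁} u₁≡2 n))
        near₂ : R₂.Null (A₂ - u₂) × R₂.Null (B₂ - y₂)
        near₂ = L₂.level-reading K₂
          (subst₂ (λ s t → B₂.Reading ρ₂ s t A₂ B₂) s≡₂ m≡₂ reading₂) (λ (_ , n) → ¬y₂ n)

        ωm′≡ : ω 0ℤ m′ ≡ w₁
        ωm′≡ = trans (sym (cong (ω 0ℤ) (at-0 s m′)))
          (at₁ col₀ (subst R₁.Simple (sym (at-0 A₁ B₁)) (simple {u₁} u₁≡2 rd₁ ¬y₁))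
                    (λ n → ¬y₂ (R₂.null-cong′ (proj₂ near₂) (subst R₂.Null (at-0 A₂ B₂) n))))

        ωm≡ : ω 0ℤ m ≡ w₀
        ωm≡ = trans
          (adjacent P {z₁ = u₁ + v} {u₂ + y₂}
            (along J₁ I₁ (π₁ ^ a) u₁ v s≡₁ m′≡₁) (along J₂ I₂ (π₂ ^ b) u₂ y₂ s≡₂ m≡₂)
            (λ n → R₁.¬null-2 (R₁.null-cong′ (subst R₁.Null (sym (eqC u₁ v)) (R₁.null-+ u₁≡2 nv)) n))
            (λ n → ¬y₂ (R₂.null-cong′ (R₂.null-lin₁ 1ℤ nu₂ (eqD u₂ y₂)) n)))
          (at₀ col₁
            (λ n → R₁.¬null-2 (R₁.null-cong′
              (R₁.null-lin₃ 1ℤ 1ℤ 1ℤ (proj₁ near₁) (proj₂ near₁) (R₁.null-+ u₁≡2 nv) (eqA A₁ B₁ u₁ v))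
              (subst R₁.Null (at-1 A₁ B₁) n)))
            (λ n → ¬y₂ (R₂.null-cong′
              (R₂.null-lin₃ 1ℤ 1ℤ 1ℤ (proj₁ near₂) (proj₂ near₂) nu₂ (eqB A₂ B₂ u₂ y₂))
              (subst R₂.Null (at-1 A₂ B₂) n))))

-- The puzzle of a domino set

module Decisions (M : Modulus) where
  open Residues M

  private
    cancel-π : ∀ {X c d} → X ≡ c * π → X ≡ d * π → c ≡ d
    cancel-π {c = c} {d} X≡ X≡′ = ℤₚ.*-cancelʳ-≡ c d π {{p-nonZero}} (trans (sym X≡) X≡′)

  -- The quantifier over all integers c is decidable because X = c p has at most one solution c.
  reads? : ∀ r X → Dec (Reads r X)
  reads? r X = (¬? (null? X) →-dec null? (r - X)) ×-dec second (null? X)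
    where
    second : Dec (Null X) → Dec (∀ c → X ≡ c * π → ¬ Null c → Null (r - c))
    second (no ¬X) = yes λ c X≡ → ⊥-elim (¬X (divides c X≡))
    second (yes (divides c X≡)) with ¬? (null? c) →-dec null? (r - c)
    ... | yes h = yes λ d X≡′ → subst (λ d → ¬ Null d → Null (r - d)) (cancel-π X≡ X≡′) h
    ... | no ¬h = no λ h → ¬h (h c X≡)

  simple? : ∀ X → Dec (Simple X)
  simple? X with null? X
  ... | no ¬X = no λ (c , X≡ , _) → ¬X (divides c X≡)
  ... | yes (divides c X≡) with null? c
  ...   | no ¬c = yes (c , X≡ , ¬c)
  ...   | yes nc = no λ (d , X≡′ , ¬d) → ¬d (subst Null (cancel-π X≡ X≡′) nc)

  module _ (X Y : ℤ) (X≡Y : π * π ∣ X - Y) where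

    close : Null (X - Y)
    close = ∣-trans (divides π refl) X≡Y

    -- A congruence modulo p² survives division by p as a congruence modulo p.
    cong-quotient : ∀ {d} → Y ≡ d * π → Σ[ c ∈ ℤ ] X ≡ c * π × Null (c - d)
    cong-quotient {d} refl = witness X≡Y
      where
      eq₁ : ∀ X z → X ≡ X - z + z
      eq₁ = solve-∀
      eq₂ : ∀ d k q → k * (q * q) + d * q ≡ (d + k * q) * q
      eq₂ = solve-∀
      eq₃ : ∀ d z → d + z - d ≡ z
      eq₃ = solve-∀
      witness : π * π ∣ X - d * π → Σ[ c ∈ ℤ ] X ≡ c * π × Null (c - d)
      witness (divides k e) = d + k * π
        , trans (eq₁ X (d * π)) (trans (cong (_+ d * π) e) (eq₂ d k π)) , divides k (eq₃ d (k * π))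

    cong-simple : Simple Y → Simple X
    cong-simple (d , Y≡ , ¬d) with cong-quotient Y≡
    ... | c , X≡ , c≡d = c , X≡ , λ nc → ¬d (null-cong′ c≡d nc)

    cong-reads : ∀ {r} → Reads r X → Reads r Y
    cong-reads {r} (rd₀ , rd₁) =
        (λ ¬Y → null-lin₂ 1ℤ 1ℤ (rd₀ (λ nX → ¬Y (null-cong′ close nX))) close (eq r X Y))
      , (λ d Y≡ ¬d → second d ¬d (cong-quotient Y≡))
      where
      eq : ∀ r X Y → r - Y ≡ 1ℤ * (r - X) + 1ℤ * (X - Y)
      eq = solve-∀
      second : ∀ d → ¬ Null d → (Σ[ c ∈ ℤ ] X ≡ c * π × Null (c - d)) → Null (r - d)
      second d ¬d (c , X≡ , c≡d) =
        null-lin₂ 1ℤ 1ℤ (rd₁ c X≡ (λ nc → ¬d (null-cong′ c≡d nc))) c≡d (eq r c d)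

-- p-adic valuations and the parts prime to p.

module Valuation (M : Modulus) where
  open Residues M

  1<p : 1 ℕ.< p
  1<p = go p p-nonZero p∤1
    where
    go : ∀ p → ℕ.NonZero p → ¬ + p ∣ 1ℤ → 1 ℕ.< p
    go (suc zero) _ p∤1 = ⊥-elim (p∤1 (divides 1ℤ refl))
    go (suc (suc p)) _ _ = s≤s (s≤s z≤n)

  private
    cancel-π : ∀ x y → π * x ≡ π * y → x ≡ y
    cancel-π x y = ℤₚ.*-cancelˡ-≡ π x y {{p-nonZero}}

  Strip : ℤ → ℤ → Set
  Strip j i = (j ≡ 0ℤ × i ≡ 0ℤ) ⊎
    (Σ[ s ∈ ℕ ] Σ[ A ∈ ℤ ] Σ[ B ∈ ℤ ] j ≡ π ^ s * A × i ≡ π ^ s * B × ¬ (Null A × Null B))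

  -- Induction on a bound f of |j| + |i|: dividing both by p > 1 lowers a positive sum strictly, and
  -- bound 0 forces j = i = 0.
  strip-within : ∀ f j i → ∣ j ∣ ℕ.+ ∣ i ∣ ℕ.≤ f → Strip j i
  strip-within zero j i size = inj₁
    ( ℤₚ.∣i∣≡0⇒i≡0 (ℕₚ.n≤0⇒n≡0 (ℕₚ.m+n≤o⇒m≤o ∣ j ∣ size))
    , ℤₚ.∣i∣≡0⇒i≡0 (ℕₚ.n≤0⇒n≡0 (ℕₚ.m+n≤o⇒n≤o ∣ j ∣ size)))
  strip-within (suc f) j i size with null? j ×-dec null? i
  ... | no ¬both = inj₂ (0 , j , i , sym (ℤₚ.*-identityˡ j) , sym (ℤₚ.*-identityˡ i) , ¬both)
  ... | yes (divides j′ j≡ , divides i′ i≡) = lift (strip-within f j′ i′ smaller)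
    where
    total : ∣ j ∣ ℕ.+ ∣ i ∣ ≡ (∣ j′ ∣ ℕ.+ ∣ i′ ∣) ℕ.* p
    total = trans (cong₂ ℕ._+_ (trans (cong ∣_∣ j≡) (ℤₚ.abs-* j′ π)) (trans (cong ∣_∣ i≡) (ℤₚ.abs-* i′ π)))
                  (sym (ℕₚ.*-distribʳ-+ p ∣ j′ ∣ ∣ i′ ∣))
    shrink : ∀ a → a ℕ.* p ℕ.≤ suc f → a ℕ.≤ f
    shrink zero _ = z≤n
    shrink (suc a) le = ℕ.s≤s⁻¹ (ℕₚ.<-≤-trans (ℕₚ.m<m*n (suc a) p 1<p) le)
    smaller : ∣ j′ ∣ ℕ.+ ∣ i′ ∣ ℕ.≤ f
    smaller = shrink (∣ j′ ∣ ℕ.+ ∣ i′ ∣) (subst (ℕ._≤ suc f) total size)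
    up : ∀ {x x′ A} s → x ≡ x′ * π → x′ ≡ π ^ s * A → x ≡ π ^ suc s * A
    up {A = A} s refl refl = eq (π ^ s) A π
      where
      eq : ∀ Q A q → Q * A * q ≡ q * Q * A
      eq = solve-∀
    lift : Strip j′ i′ → Strip j i
    lift (inj₁ (refl , refl)) = inj₁ (j≡ , i≡)
    lift (inj₂ (s , A , B , j′≡ , i′≡ , ¬AB)) = inj₂ (suc s , A , B , up s j≡ j′≡ , up s i≡ i′≡ , ¬AB)

  strip : ∀ j i → Strip j i
  strip j i = strip-within _ j i ℕₚ.≤-refl

  -- 0 is treated like 1.
  leading : ∀ {x} → Strip 0ℤ x → ℕ × ℤ
  leading (inj₁ _) = 0 , 1ℤ
  leading (inj₂ (s , A , B , _)) = s , B

  -- A single number is stripped as the pair (0, x); the coefficient A is then 0, so properness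
  -- falls on B.
  valuation : ℤ → ℕ
  valuation x = proj₁ (leading (strip 0ℤ x))

  cofactor : ℤ → ℤ
  cofactor x = proj₂ (leading (strip 0ℤ x))

  private
    pow-zero : ∀ s {A} → 0ℤ ≡ π ^ s * A → A ≡ 0ℤ
    pow-zero zero {A} e = sym (trans e (ℤₚ.*-identityˡ A))
    pow-zero (suc s) {A} e = pow-zero s
      (cancel-π 0ℤ (π ^ s * A) (trans (ℤₚ.*-zeroʳ π) (trans e (ℤₚ.*-assoc π (π ^ s) A))))

  pow-unique : ∀ s t {X Y} → π ^ s * X ≡ π ^ t * Y → ¬ Null X → ¬ Null Y → s ≡ t × X ≡ Y
  pow-unique zero zero {X} {Y} e _ _ = refl , trans (sym (ℤₚ.*-identityˡ X)) (trans e (ℤₚ.*-identityˡ Y))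
  pow-unique zero (suc t) {X} {Y} e ¬X _ =
    ⊥-elim (¬X (divides (π ^ t * Y) (trans (sym (ℤₚ.*-identityˡ X)) (trans e (eq π (π ^ t) Y)))))
    where
    eq : ∀ q Q Y → q * Q * Y ≡ Q * Y * q
    eq = solve-∀
  pow-unique (suc s) zero {X} {Y} e _ ¬Y =
    ⊥-elim (¬Y (divides (π ^ s * X) (trans (sym (ℤₚ.*-identityˡ Y)) (trans (sym e) (eq π (π ^ s) X)))))
    where
    eq : ∀ q Q Y → q * Q * Y ≡ Q * Y * q
    eq = solve-∀
  pow-unique (suc s) (suc t) {X} {Y} e ¬X ¬Y
    with pow-unique s t (cancel-π (π ^ s * X) (π ^ t * Y)
           (trans (sym (ℤₚ.*-assoc π (π ^ s) X)) (trans e (ℤₚ.*-assoc π (π ^ t) Y)))) ¬X ¬Y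
  ... | refl , X≡Y = refl , X≡Y

  leading-unique : ∀ {x} (σ : Strip 0ℤ x) s {X} → x ≡ π ^ s * X → ¬ Null X →
                   proj₁ (leading σ) ≡ s × proj₂ (leading σ) ≡ X
  leading-unique (inj₁ (_ , refl)) s {X} x≡ ¬X = ⊥-elim (¬X (subst Null (sym (pow-zero s x≡)) null-0))
  leading-unique (inj₂ (t , A , B , 0≡ , x≡′ , ¬AB)) s x≡ ¬X =
    pow-unique t s (trans (sym x≡′) x≡)
      (λ nB → ¬AB (subst Null (sym (pow-zero t 0≡)) null-0 , nB)) ¬X

  valuation-unique : ∀ {x} s {X} → x ≡ π ^ s * X → ¬ Null X → valuation x ≡ s × cofactor x ≡ X
  valuation-unique {x} = leading-unique (strip 0ℤ x)

  leading-zero : (σ : Strip 0ℤ 0ℤ) → leading σ ≡ (0 , 1ℤ)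
  leading-zero (inj₁ _) = refl
  leading-zero (inj₂ (s , A , B , 0≡ , 0≡′ , ¬AB)) =
    ⊥-elim (¬AB (subst Null (sym (pow-zero s 0≡)) null-0 , subst Null (sym (pow-zero s 0≡′)) null-0))

isYes-sound : ∀ {A : Set} (a? : Dec A) → isYes a? ≡ true → A
isYes-sound a? e = toWitness {a? = a?} (subst T (sym e) tt)

isYes-complete : ∀ {A : Set} (a? : Dec A) → A → isYes a? ≡ true
isYes-complete a? a = Equivalence.to Bool.T-≡ (fromWitness {a? = a?} a)

πq-residue : ∀ q′ m → + suc q′ ∣ m - + toℕ (πq q′ m)
πq-residue q′ m = divides (m /ℕ suc q′)
  (trans (cong₂ _-_ (a≡a%ℕn+[a/ℕn]*n m (suc q′)) (cong +_ (toℕ-fromℕ< (n%ℕd<d m (suc q′)))))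
         (eq (+ (m %ℕ suc q′)) ((m /ℕ suc q′) * + suc q′)))
  where
  eq : ∀ r z → r + z - r ≡ z
  eq = solve-∀

-- The period q is a common multiple of both bases and at least 2, so that 0 and 1 are distinct
-- residues; the Bezout relation feeds the Chinese remainder theorem.
record Frame : Set where
  field
    M₁ M₂  : Modulus
    N      : ℕ
    {{N-nonZero}} : ℕ.NonZero N
    wide₁  : 12 ℕ.* Modulus.p M₁ ℕ.≤ N
    wide₂  : 12 ℕ.* Modulus.p M₂ ℕ.≤ N
    q-2    : ℕ
    p₁∣q   : + Modulus.p M₁ ∣ + suc (suc q-2)
    p₂∣q   : + Modulus.p M₂ ∣ + suc (suc q-2)
    u v    : ℤ
    bezout : u * + Modulus.p M₁ + v * + Modulus.p M₂ ≡ 1ℤ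

  q-1 q : ℕ
  q-1 = suc q-2
  q = suc q-1

-- Digits, Sudoku rule and initial condition.

module Puzzle (Φ : Frame) (R : DominoSet) where
  open Frame Φ
  open DominoSet R using (w; W) renaming (R₁ to H; R₂ to V)
  module R₁ = Residues M₁
  module R₂ = Residues M₂

  -- A digit packs a residue, two last nonzero digits and a tile. `pred` compensates for the digit
  -- set being `Fin (suc d)`.
  d : ℕ
  d = ℕ.pred (q ℕ.* (q ℕ.* (q ℕ.* suc w)))

  Digit : Set
  Digit = Fin (suc d)

  encode : Fin q → Fin q → Fin q → W → Digit
  encode e r₁ r₂ x = combine {q} e (combine {q} r₁ (combine {q} {suc w} r₂ x))

  residue : Digit → Fin q
  residue δ = proj₁ (remQuot {q} (q ℕ.* (q ℕ.* suc w)) δ)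

  private
    tail₁ : Digit → Fin (q ℕ.* (q ℕ.* suc w))
    tail₁ δ = proj₂ (remQuot {q} (q ℕ.* (q ℕ.* suc w)) δ)
    tail₂ : Digit → Fin (q ℕ.* suc w)
    tail₂ δ = proj₂ (remQuot {q} (q ℕ.* suc w) (tail₁ δ))

  last₁ last₂ : Digit → Fin q
  last₁ δ = proj₁ (remQuot {q} (q ℕ.* suc w) (tail₁ δ))
  last₂ δ = proj₁ (remQuot {q} (suc w) (tail₂ δ))

  tile : Digit → W
  tile δ = proj₂ (remQuot {q} (suc w) (tail₂ δ))

  module _ (e r₁ r₂ : Fin q) (x : W) where

    residue-encode : residue (encode e r₁ r₂ x) ≡ e
    residue-encode = cong proj₁ (remQuot-combine {q} e (combine {q} r₁ (combine {q} r₂ x)))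

    private
      tail₁-encode : tail₁ (encode e r₁ r₂ x) ≡ combine {q} r₁ (combine {q} r₂ x)
      tail₁-encode = cong proj₂ (remQuot-combine {q} e (combine {q} r₁ (combine {q} r₂ x)))

      split₁ : remQuot {q} (q ℕ.* suc w) (tail₁ (encode e r₁ r₂ x)) ≡ (r₁ , combine {q} r₂ x)
      split₁ = trans (cong (remQuot {q} (q ℕ.* suc w)) tail₁-encode) (remQuot-combine {q} r₁ (combine {q} r₂ x))

      split₂ : remQuot {q} (suc w) (tail₂ (encode e r₁ r₂ x)) ≡ (r₂ , x)
      split₂ = trans (cong (λ z → remQuot {q} (suc w) (proj₂ z)) split₁) (remQuot-combine {q} r₂ x)

    last₁-encode : last₁ (encode e r₁ r₂ x) ≡ r₁
    last₁-encode = cong proj₁ split₁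

    last₂-encode : last₂ (encode e r₁ r₂ x) ≡ r₂
    last₂-encode = cong proj₁ split₂

    tile-encode : tile (encode e r₁ r₂ x) ≡ x
    tile-encode = cong proj₂ split₂

  int : ∀ {k} → Fin k → ℤ
  int f = + toℕ f

  -- The tile is prescribed only at the levels (0,0), (1,0) and (0,1) relative to the line; at
  -- deeper points the line leaves it free.
  record Cell (δ : Digit) (X₁ X₂ : ℤ) (w₀ w₁ w₂ : W) : Set where
    field
      reads₁ : R₁.Reads (int (last₁ δ)) X₁
      reads₂ : R₂.Reads (int (last₂ δ)) X₂
      at₀    : ¬ R₁.Null X₁ → ¬ R₂.Null X₂ → tile δ ≡ w₀
      at₁    : R₁.Simple X₁ → ¬ R₂.Null X₂ → tile δ ≡ w₁
      at₂    : R₂.Simple X₂ → ¬ R₁.Null X₁ → tile δ ≡ w₂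

  record LineAt (g : Fin N → Digit) (A₁ B₁ A₂ B₂ : ℤ) (w₀ w₁ w₂ : W) : Set where
    field
      proper₁ : ¬ (R₁.Null A₁ × R₁.Null B₁)
      proper₂ : ¬ (R₂.Null A₂ × R₂.Null B₂)
      related₁ : H w₀ w₁ ≡ true
      related₂ : V w₀ w₂ ≡ true
      cell : ∀ n → Cell (g n) (A₁ * int n + B₁) (A₂ * int n + B₂) w₀ w₁ w₂

  q² : ℕ
  q² = q ℕ.* q

  IntLines FinLines Rule : (Fin N → Digit) → Set
  IntLines g = Σ[ A₁ ∈ ℤ ] Σ[ B₁ ∈ ℤ ] Σ[ A₂ ∈ ℤ ] Σ[ B₂ ∈ ℤ ]
    Σ[ w₀ ∈ W ] Σ[ w₁ ∈ W ] Σ[ w₂ ∈ W ] LineAt g A₁ B₁ A₂ B₂ w₀ w₁ w₂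
  -- Reads and Simple depend on X only modulo p², so that coefficients below q² suffice.
  FinLines g = Σ[ A₁ ∈ Fin q² ] Σ[ B₁ ∈ Fin q² ] Σ[ A₂ ∈ Fin q² ] Σ[ B₂ ∈ Fin q² ]
    Σ[ w₀ ∈ W ] Σ[ w₁ ∈ W ] Σ[ w₂ ∈ W ] LineAt g (int A₁) (int B₁) (int A₂) (int B₂) w₀ w₁ w₂
  Rule g =
    (Σ[ A ∈ Fin q ] Σ[ B ∈ Fin q ] ∀ n → + q ∣ int (residue (g n)) - (int A * int n + int B)) × FinLines g

  -- The first condition makes every residue occur in every column; the other two start the
  -- induction over levels by giving normal boards at level 0.
  Initial : Fin q → Digit → Set
  Initial c δ = residue δ ≡ c
    × (¬ R₁.Null (int (residue δ)) → R₁.Null (int (last₁ δ) - int (residue δ)))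
    × (¬ R₂.Null (int (residue δ)) → R₂.Null (int (last₂ δ) - int (residue δ)))

  private
    module D₁ = Decisions M₁
    module D₂ = Decisions M₂

  abstract
    cell? : ∀ δ X₁ X₂ w₀ w₁ w₂ → Dec (Cell δ X₁ X₂ w₀ w₁ w₂)
    cell? δ X₁ X₂ w₀ w₁ w₂ = map′
      (λ (a , b , c , d , e) → record { reads₁ = a ; reads₂ = b ; at₀ = c ; at₁ = d ; at₂ = e })
      (λ z → let open Cell z in reads₁ , reads₂ , at₀ , at₁ , at₂)
      (D₁.reads? (int (last₁ δ)) X₁ ×-dec D₂.reads? (int (last₂ δ)) X₂ ×-dec
       (¬? (R₁.null? X₁) →-dec ¬? (R₂.null? X₂) →-dec tile δ ≟F w₀) ×-dec
       (D₁.simple? X₁ →-dec ¬? (R₂.null? X₂) →-dec tile δ ≟F w₁) ×-dec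
       (D₂.simple? X₂ →-dec ¬? (R₁.null? X₁) →-dec tile δ ≟F w₂))

    lineAt? : ∀ g A₁ B₁ A₂ B₂ w₀ w₁ w₂ → Dec (LineAt g A₁ B₁ A₂ B₂ w₀ w₁ w₂)
    lineAt? g A₁ B₁ A₂ B₂ w₀ w₁ w₂ = map′
      (λ (a , b , c , d , e) → record { proper₁ = a ; proper₂ = b ; related₁ = c ; related₂ = d ; cell = e })
      (λ z → let open LineAt z in proper₁ , proper₂ , related₁ , related₂ , cell)
      (¬? (R₁.null? A₁ ×-dec R₁.null? B₁) ×-dec ¬? (R₂.null? A₂ ×-dec R₂.null? B₂) ×-dec
       (H w₀ w₁ Bool.≟ true) ×-dec (V w₀ w₂ Bool.≟ true) ×-dec
       all? (λ n → cell? (g n) (A₁ * int n + B₁) (A₂ * int n + B₂) w₀ w₁ w₂))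

    rule? : ∀ g → Dec (Rule g)
    rule? g =
      (any? λ A → any? λ B → all? λ n → + q ∣? int (residue (g n)) - (int A * int n + int B)) ×-dec
      (any? λ A₁ → any? λ B₁ → any? λ A₂ → any? λ B₂ → any? λ w₀ → any? λ w₁ → any? λ w₂ →
        lineAt? g (int A₁) (int B₁) (int A₂) (int B₂) w₀ w₁ w₂)

    initial? : ∀ c δ → Dec (Initial c δ)
    initial? c δ = (residue δ ≟F c) ×-dec
      (¬? (R₁.null? (int (residue δ))) →-dec R₁.null? (int (last₁ δ) - int (residue δ))) ×-dec
      (¬? (R₂.null? (int (residue δ))) →-dec R₂.null? (int (last₂ δ) - int (residue δ)))

  puzzle : SudokuPuzzle
  puzzle = record
    { N = N ; d = d ; q' = q-1
    ; S = λ g → isYes (rule? g)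
    ; C = λ c δ → isYes (initial? c δ) }

  -- The board written from a tiling solves the puzzle.

  module FromTiling (T : ℕ → ℕ → W) (isT : IsDominoFunctionℕ² R T) where
    private
      module V₁ = Valuation M₁
      module V₂ = Valuation M₂

    mark : ℤ → Digit
    mark x = encode (πq q-1 x) (πq q-1 (V₁.cofactor x)) (πq q-1 (V₂.cofactor x)) (T (V₁.valuation x) (V₂.valuation x))

    residue-mark : ∀ x → residue (mark x) ≡ πq q-1 x
    residue-mark x = residue-encode (πq q-1 x) (πq q-1 (V₁.cofactor x)) (πq q-1 (V₂.cofactor x))
                       (T (V₁.valuation x) (V₂.valuation x))

    tile-mark : ∀ x → tile (mark x) ≡ T (V₁.valuation x) (V₂.valuation x)
    tile-mark x = tile-encode (πq q-1 x) (πq q-1 (V₁.cofactor x)) (πq q-1 (V₂.cofactor x))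
                    (T (V₁.valuation x) (V₂.valuation x))

    last₁-mark : ∀ x X → V₁.cofactor x ≡ X → R₁.Null (int (last₁ (mark x)) - X)
    last₁-mark x X refl = R₁.null-lin₁ (- 1ℤ) (∣-trans p₁∣q (πq-residue q-1 (V₁.cofactor x)))
      (trans (cong (λ f → int f - V₁.cofactor x) (last₁-encode (πq q-1 x) (πq q-1 (V₁.cofactor x)) (πq q-1 (V₂.cofactor x))
                     (T (V₁.valuation x) (V₂.valuation x))))
             (eq (int (πq q-1 (V₁.cofactor x))) (V₁.cofactor x)))
      where
      eq : ∀ r y → r - y ≡ (- 1ℤ) * (y - r)
      eq = solve-∀

    last₂-mark : ∀ x X → V₂.cofactor x ≡ X → R₂.Null (int (last₂ (mark x)) - X)
    last₂-mark x X refl = R₂.null-lin₁ (- 1ℤ) (∣-trans p₂∣q (πq-residue q-1 (V₂.cofactor x)))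
      (trans (cong (λ f → int f - V₂.cofactor x) (last₂-encode (πq q-1 x) (πq q-1 (V₁.cofactor x)) (πq q-1 (V₂.cofactor x))
                     (T (V₁.valuation x) (V₂.valuation x))))
             (eq (int (πq q-1 (V₂.cofactor x))) (V₂.cofactor x)))
      where
      eq : ∀ r y → r - y ≡ (- 1ℤ) * (y - r)
      eq = solve-∀

    private
      deeper : ∀ Q c q → Q * (c * q) ≡ q * Q * c
      deeper = solve-∀

    -- A unit X makes s the valuation of x and X its cofactor; for X = c p with a unit c they are s
    -- + 1 and c. In all remaining cases the conditions of `Cell` are vacuous for that prime.
    cell-mark : ∀ {x X₁ X₂} s₁ s₂ → x ≡ R₁.π ^ s₁ * X₁ → x ≡ R₂.π ^ s₂ * X₂ →
                Cell (mark x) X₁ X₂ (T s₁ s₂) (T (suc s₁) s₂) (T s₁ (suc s₂))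
    cell-mark {x} {X₁} {X₂} s₁ s₂ x≡₁ x≡₂ = record
      { reads₁ = (λ ¬X → last₁-mark x X₁ (proj₂ (exact₁ ¬X)))
               , (λ c X≡ ¬c → last₁-mark x c (proj₂ (simple₁ c X≡ ¬c)))
      ; reads₂ = (λ ¬X → last₂-mark x X₂ (proj₂ (exact₂ ¬X)))
               , (λ c X≡ ¬c → last₂-mark x c (proj₂ (simple₂ c X≡ ¬c)))
      ; at₀ = λ ¬X₁ ¬X₂ → trans (tile-mark x) (cong₂ T (proj₁ (exact₁ ¬X₁)) (proj₁ (exact₂ ¬X₂)))
      ; at₁ = λ (c , X≡ , ¬c) ¬X₂ → trans (tile-mark x) (cong₂ T (proj₁ (simple₁ c X≡ ¬c)) (proj₁ (exact₂ ¬X₂)))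
      ; at₂ = λ (c , X≡ , ¬c) ¬X₁ → trans (tile-mark x) (cong₂ T (proj₁ (exact₁ ¬X₁)) (proj₁ (simple₂ c X≡ ¬c)))
      }
      where
      exact₁ : ¬ R₁.Null X₁ → V₁.valuation x ≡ s₁ × V₁.cofactor x ≡ X₁
      exact₁ = V₁.valuation-unique s₁ x≡₁
      exact₂ : ¬ R₂.Null X₂ → V₂.valuation x ≡ s₂ × V₂.cofactor x ≡ X₂
      exact₂ = V₂.valuation-unique s₂ x≡₂
      simple₁ : ∀ c → X₁ ≡ c * R₁.π → ¬ R₁.Null c → V₁.valuation x ≡ suc s₁ × V₁.cofactor x ≡ c
      simple₁ c refl = V₁.valuation-unique (suc s₁) (trans x≡₁ (deeper (R₁.π ^ s₁) c R₁.π))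
      simple₂ : ∀ c → X₂ ≡ c * R₂.π → ¬ R₂.Null c → V₂.valuation x ≡ suc s₂ × V₂.cofactor x ≡ c
      simple₂ c refl = V₂.valuation-unique (suc s₂) (trans x≡₂ (deeper (R₂.π ^ s₂) c R₂.π))

    -- The line j = i = 0 has no finite power of p to remove. As 0 is marked like 1 in last digits
    -- and valuations, the constant function 1 at levels (0,0) serves as its reading.
    cell-mark-zero : ∀ {x} → x ≡ 0ℤ → Cell (mark x) 1ℤ 1ℤ (T 0 0) (T 1 0) (T 0 1)
    cell-mark-zero refl = record
      { reads₁ = (λ _ → last₁-mark 0ℤ 1ℤ (cong proj₂ z₁)) , (λ c 1≡ _ → ⊥-elim (R₁.¬null-1 (divides c 1≡)))
      ; reads₂ = (λ _ → last₂-mark 0ℤ 1ℤ (cong proj₂ z₂)) , (λ c 1≡ _ → ⊥-elim (R₂.¬null-1 (divides c 1≡)))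
      ; at₀ = λ _ _ → trans (tile-mark 0ℤ) (cong₂ T (cong proj₁ z₁) (cong proj₁ z₂))
      ; at₁ = λ (c , 1≡ , _) _ → ⊥-elim (R₁.¬null-1 (divides c 1≡))
      ; at₂ = λ (c , 1≡ , _) _ → ⊥-elim (R₂.¬null-1 (divides c 1≡)) }
      where
      z₁ = V₁.leading-zero (V₁.strip 0ℤ 0ℤ)
      z₂ = V₂.leading-zero (V₂.strip 0ℤ 0ℤ)

    line : ℤ → ℤ → Fin N → Digit
    line j i n = mark (j * int n + i)

    lineAt-mark : ∀ j i → IntLines (line j i)
    lineAt-mark j i = combined (V₁.strip j i) (V₂.strip j i)
      where
      factor : ∀ {j i} Q A B n → j ≡ Q * A → i ≡ Q * B → j * n + i ≡ Q * (A * n + B)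
      factor Q A B n refl refl = eq Q A B n
        where
        eq : ∀ Q A B n → Q * A * n + Q * B ≡ Q * (A * n + B)
        eq = solve-∀
      zero-line : j ≡ 0ℤ → i ≡ 0ℤ → IntLines (line j i)
      zero-line j≡0 i≡0 = 0ℤ , 1ℤ , 0ℤ , 1ℤ , T 0 0 , T 1 0 , T 0 1 , record
        { proper₁ = λ (_ , n) → R₁.¬null-1 n
        ; proper₂ = λ (_ , n) → R₂.¬null-1 n
        ; related₁ = proj₁ isT 0 0
        ; related₂ = proj₂ isT 0 0
        ; cell = λ n → subst₂ (λ X Y → Cell (line j i n) X Y (T 0 0) (T 1 0) (T 0 1))
                   (sym (eq₁ (int n))) (sym (eq₁ (int n)))
                   (cell-mark-zero (trans (cong₂ (λ j i → j * int n + i) j≡0 i≡0) (eq₀ (int n)))) }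
        where
        eq₀ : ∀ n → 0ℤ * n + 0ℤ ≡ 0ℤ
        eq₀ = solve-∀
        eq₁ : ∀ n → 0ℤ * n + 1ℤ ≡ 1ℤ
        eq₁ = solve-∀
      combined : V₁.Strip j i → V₂.Strip j i → IntLines (line j i)
      combined (inj₁ (j≡0 , i≡0)) _ = zero-line j≡0 i≡0
      combined _ (inj₁ (j≡0 , i≡0)) = zero-line j≡0 i≡0
      combined (inj₂ (s₁ , A₁ , B₁ , j≡₁ , i≡₁ , ¬₁)) (inj₂ (s₂ , A₂ , B₂ , j≡₂ , i≡₂ , ¬₂)) =
        A₁ , B₁ , A₂ , B₂ , T s₁ s₂ , T (suc s₁) s₂ , T s₁ (suc s₂) , record
          { proper₁ = ¬₁ ; proper₂ = ¬₂
          ; related₁ = proj₁ isT s₁ s₂ ; related₂ = proj₂ isT s₁ s₂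
          ; cell = λ n → cell-mark s₁ s₂ (factor (R₁.π ^ s₁) A₁ B₁ (int n) j≡₁ i≡₁)
                                         (factor (R₂.π ^ s₂) A₂ B₂ (int n) j≡₂ i≡₂) }

    reduce : ℤ → Fin q²
    reduce = πq (ℕ.pred q²)

    private
      square-∣ : ∀ {a b} → a ∣ b → a * a ∣ b * b
      square-∣ {a} (divides k refl) = divides (k * k) (eq k a)
        where
        eq : ∀ k a → k * a * (k * a) ≡ k * k * (a * a)
        eq = solve-∀

      module Reduced {p} (p∣q : + p ∣ + q) where
        reduce-≡ : ∀ A → + p * + p ∣ A - int (reduce A)
        reduce-≡ A = ∣-trans (square-∣ p∣q) (πq-residue (ℕ.pred q²) A)

        reduce-line : ∀ A B n → + p * + p ∣ (A * n + B) - (int (reduce A) * n + int (reduce B))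
        reduce-line A B n = conclude (reduce-≡ A) (reduce-≡ B)
          where
          eq : ∀ A A′ B B′ n → (A * n + B) - (A′ * n + B′) ≡ (A - A′) * n + (B - B′)
          eq = solve-∀
          eq′ : ∀ k l n z → k * z * n + l * z ≡ (k * n + l) * z
          eq′ = solve-∀
          conclude : + p * + p ∣ A - int (reduce A) → + p * + p ∣ B - int (reduce B) →
                     + p * + p ∣ (A * n + B) - (int (reduce A) * n + int (reduce B))
          conclude (divides k e) (divides l f) = divides (k * n + l)
            (trans (eq A (int (reduce A)) B (int (reduce B)) n)
              (trans (cong₂ (λ x y → x * n + y) e f) (eq′ k l n (+ p * + p))))

      module Red₁ = Reduced p₁∣q
      module Red₂ = Reduced p₂∣q

    cell-cong : ∀ {δ X₁ X₂ Y₁ Y₂ w₀ w₁ w₂} → R₁.π * R₁.π ∣ X₁ - Y₁ → R₂.π * R₂.π ∣ X₂ - Y₂ →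
                Cell δ X₁ X₂ w₀ w₁ w₂ → Cell δ Y₁ Y₂ w₀ w₁ w₂
    cell-cong {δ} {X₁} {X₂} {Y₁} {Y₂} e₁ e₂ c = record
      { reads₁ = D₁.cong-reads X₁ Y₁ e₁ {int (last₁ δ)} reads₁
      ; reads₂ = D₂.cong-reads X₂ Y₂ e₂ {int (last₂ δ)} reads₂
      ; at₀ = λ ¬Y₁ ¬Y₂ → at₀ (λ n → ¬Y₁ (R₁.null-cong′ (D₁.close X₁ Y₁ e₁) n)) (λ n → ¬Y₂ (R₂.null-cong′ (D₂.close X₂ Y₂ e₂) n))
      ; at₁ = λ s ¬Y₂ → at₁ (D₁.cong-simple X₁ Y₁ e₁ s) (λ n → ¬Y₂ (R₂.null-cong′ (D₂.close X₂ Y₂ e₂) n))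
      ; at₂ = λ s ¬Y₁ → at₂ (D₂.cong-simple X₂ Y₂ e₂ s) (λ n → ¬Y₁ (R₁.null-cong′ (D₁.close X₁ Y₁ e₁) n)) }
      where open Cell c

    rule-mark : ∀ j i → Rule (line j i)
    rule-mark j i = (πq q-1 j , πq q-1 i , affine) , finite (lineAt-mark j i)
      where
      affine : ∀ n → + q ∣ int (residue (line j i n)) - (int (πq q-1 j) * int n + int (πq q-1 i))
      affine n = conclude (πq-residue q-1 (j * int n + i)) (πq-residue q-1 j) (πq-residue q-1 i)
        where
        eq : ∀ j i x e j′ i′ → e - (j′ * x + i′) ≡ (j - j′) * x + (i - i′) - (j * x + i - e)
        eq = solve-∀
        eq′ : ∀ k l m x z → l * z * x + m * z - k * z ≡ (l * x + m - k) * z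
        eq′ = solve-∀
        conclude : + q ∣ (j * int n + i) - int (πq q-1 (j * int n + i)) → + q ∣ j - int (πq q-1 j) →
                   + q ∣ i - int (πq q-1 i) →
                   + q ∣ int (residue (line j i n)) - (int (πq q-1 j) * int n + int (πq q-1 i))
        conclude (divides k e) (divides l f) (divides m g) = divides (l * int n + m - k)
          (trans (cong (λ z → int z - (int (πq q-1 j) * int n + int (πq q-1 i))) (residue-mark (j * int n + i)))
          (trans (eq j i (int n) (int (πq q-1 (j * int n + i))) (int (πq q-1 j)) (int (πq q-1 i)))
          (trans (cong₂ _-_ (cong₂ (λ x y → x * int n + y) f g) e) (eq′ k l m (int n) (+ q)))))
      finite : IntLines (line j i) → FinLines (line j i)
      finite (A₁ , B₁ , A₂ , B₂ , w₀ , w₁ , w₂ , l) =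
        reduce A₁ , reduce B₁ , reduce A₂ , reduce B₂ , w₀ , w₁ , w₂ , record
          { proper₁ = λ (nA , nB) → proper₁
              ( R₁.null-cong (D₁.close A₁ (int (reduce A₁)) (Red₁.reduce-≡ A₁)) nA
              , R₁.null-cong (D₁.close B₁ (int (reduce B₁)) (Red₁.reduce-≡ B₁)) nB)
          ; proper₂ = λ (nA , nB) → proper₂
              ( R₂.null-cong (D₂.close A₂ (int (reduce A₂)) (Red₂.reduce-≡ A₂)) nA
              , R₂.null-cong (D₂.close B₂ (int (reduce B₂)) (Red₂.reduce-≡ B₂)) nB)
          ; related₁ = related₁ ; related₂ = related₂
          ; cell = λ n → cell-cong
                     {X₁ = A₁ * int n + B₁} {A₂ * int n + B₂}
                     {int (reduce A₁) * int n + int (reduce B₁)} {int (reduce A₂) * int n + int (reduce B₂)}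
                     (Red₁.reduce-line A₁ B₁ (int n)) (Red₂.reduce-line A₂ B₂ (int n)) (cell n) }
        where open LineAt l

    initial-mark : ∀ m → Initial (πq q-1 m) (mark m)
    initial-mark m = residue-mark m
      , subst (λ f → ¬ R₁.Null (int f) → R₁.Null (int (last₁ (mark m)) - int f)) (sym (residue-mark m))
          (λ ¬e → R₁.null-lin₂ 1ℤ 1ℤ
            (last₁-mark m m (proj₂ (V₁.valuation-unique {m} 0 (sym (ℤₚ.*-identityˡ m)) (λ n → ¬e (R₁.null-cong′ near₁ n)))))
            near₁ (eq (int (last₁ (mark m))) m (int (πq q-1 m))))
      , subst (λ f → ¬ R₂.Null (int f) → R₂.Null (int (last₂ (mark m)) - int f)) (sym (residue-mark m))
          (λ ¬e → R₂.null-lin₂ 1ℤ 1ℤ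
            (last₂-mark m m (proj₂ (V₂.valuation-unique {m} 0 (sym (ℤₚ.*-identityˡ m)) (λ n → ¬e (R₂.null-cong′ near₂ n)))))
            near₂ (eq (int (last₂ (mark m))) m (int (πq q-1 m))))
      where
      near₁ : R₁.Null (m - int (πq q-1 m))
      near₁ = ∣-trans p₁∣q (πq-residue q-1 m)
      near₂ : R₂.Null (m - int (πq q-1 m))
      near₂ = ∣-trans p₂∣q (πq-residue q-1 m)
      eq : ∀ r m e → r - e ≡ 1ℤ * (r - m) + 1ℤ * (m - e)
      eq = solve-∀

    solution : SudokuSolvable puzzle
    solution = (λ _ m → mark m)
             , (λ j i → isYes-complete (rule? (line j i)) (rule-mark j i))
             , (λ n → Perm.id , λ m → isYes-complete (initial? (πq q-1 m) (mark m)) (initial-mark m))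

-- From Sudoku solutions to tilings

module Bezout where

  Coprime : ℤ → ℤ → Set
  Coprime x y = Σ[ u ∈ ℤ ] Σ[ v ∈ ℤ ] u * x + v * y ≡ 1ℤ

  coprime-sym : ∀ {x y} → Coprime x y → Coprime y x
  coprime-sym {x} {y} (u , v , e) = v , u , trans (ℤₚ.+-comm (v * y) (u * x)) e

  -- The product of the Bezout relations for x and for its a-th power is one for the next power.
  coprime-^ : ∀ {x y} → Coprime x y → ∀ a → Coprime (x ^ a) y
  coprime-^ {x} {y} _ zero = 1ℤ , 0ℤ , refl
  coprime-^ {x} {y} c@(u , v , e) (suc a) with coprime-^ c a
  ... | u′ , v′ , e′ = u * u′ , u * x * v′ + v * (u′ * x ^ a + v′ * y)
    , trans (eq u v u′ v′ x y (x ^ a)) (cong₂ _*_ e e′)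
    where
    eq : ∀ u v u′ v′ x y Q → u * u′ * (x * Q) + (u * x * v′ + v * (u′ * Q + v′ * y)) * y ≡
         (u * x + v * y) * (u′ * Q + v′ * y)
    eq = solve-∀

  crt : ∀ {x y} → Coprime x y → ∀ a b X Y → Σ[ k ∈ ℤ ] Σ[ l ∈ ℤ ] X + x ^ a * k ≡ Y + y ^ b * l
  crt {x} {y} c a b X Y = solution (coprime-^ {y} {x ^ a} (coprime-sym {x ^ a} {y} (coprime-^ c a)) b)
    where
    eq₁ : ∀ X Y P Q u v → X + P * (u * (Y - X)) ≡ Y + Q * (- (v * (Y - X))) + ((v * Q + u * P) - 1ℤ) * (Y - X)
    eq₁ = solve-∀
    eq₂ : ∀ z D → z + (1ℤ - 1ℤ) * D ≡ z
    eq₂ = solve-∀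
    solution : Coprime (y ^ b) (x ^ a) → Σ[ k ∈ ℤ ] Σ[ l ∈ ℤ ] X + x ^ a * k ≡ Y + y ^ b * l
    solution (v , u , e) = u * (Y - X) , - (v * (Y - X)) ,
      trans (eq₁ X Y (x ^ a) (y ^ b) u v)
        (trans (cong (λ z → Y + y ^ b * (- (v * (Y - X))) + (z - 1ℤ) * (Y - X)) e)
               (eq₂ (Y + y ^ b * (- (v * (Y - X)))) (Y - X)))

πq-toℕ : ∀ q′ (f : Fin (suc q′)) → πq q′ (+ toℕ f) ≡ f
πq-toℕ q′ f = toℕ-injective (trans (toℕ-fromℕ< (n%ℕd<d (+ toℕ f) (suc q′))) (m<n⇒m%n≡m (toℕ<n f)))

-- The tiling found at the levels of a solution.

module FromSudoku (Φ : Frame) (R : DominoSet) where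
  open Frame Φ
  open Puzzle Φ R
  open DominoSet R using (W) renaming (R₁ to H; R₂ to V)
  private
    module B₁ = Boards M₁ N wide₁
    module B₂ = Boards M₂ N wide₂
    module L₁ = Levels M₁ N wide₁
    module L₂ = Levels M₂ N wide₂
    module Base₁ = BaseLevel M₁ N wide₁
    module Base₂ = BaseLevel M₂ N wide₂
    module S₁ = DominoStep M₁ M₂ N wide₁ wide₂
    module S₂ = DominoStep M₂ M₁ N wide₂ wide₁

  module _ (F : Fin N → ℤ → Digit) (solves : IsSudokuSolution puzzle F) (obeys : Obeys puzzle F) where

    -- Reduction modulo N makes the board total in integer columns; on true columns it is the
    -- identity by `int-column`.
    column : ℤ → Fin N
    column n = ∣ n ∣ mod N

    int-column : ∀ {n} → Column N n → int (column n) ≡ n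
    int-column (k , k<N , refl) = cong +_ (trans (toℕ-fromℕ< _) (m<n⇒m%n≡m k<N))

    rule : ∀ j i → Rule (λ n → F n (j * int n + i))
    rule j i = isYes-sound (rule? _) (solves j i)

    initial : ∀ n m → Initial (Inverse.to (proj₁ (obeys n)) (πq q-1 m)) (F n m)
    initial n m = isYes-sound (initial? _ _) (proj₂ (obeys n) m)

    preimage : ∀ n c → Σ[ m ∈ ℤ ] residue (F n m) ≡ c
    preimage n c = int (Inverse.from σ c)
      , trans (proj₁ (initial n _))
          (trans (cong (Inverse.to σ) (πq-toℕ q-1 (Inverse.from σ c))) (Inverse.strictlyInverseˡ σ c))
      where σ = proj₁ (obeys n)

    ε r₁ r₂ : ℤ → ℤ → ℤ
    ε n m = int (residue (F (column n) m))
    r₁ n m = int (last₁ (F (column n) m))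
    r₂ n m = int (last₂ (F (column n) m))

    ω : ℤ → ℤ → W
    ω n m = tile (F (column n) m)

    ε-affine : ∀ j i → Σ[ A ∈ ℤ ] Σ[ B ∈ ℤ ] ∀ {n} → Column N n → + q ∣ ε n (j * n + i) - (A * n + B)
    ε-affine j i with rule j i
    ... | (A , B , h) , _ = int A , int B , λ {n} col →
      subst (λ z → + q ∣ ε n (j * z + i) - (int A * z + int B)) (int-column col) (h (column n))

    affine₁ : ∀ j i → Σ[ A ∈ ℤ ] Σ[ B ∈ ℤ ] ∀ {n} → Column N n → R₁.Null (ε n (j * n + i) - (A * n + B))
    affine₁ j i with ε-affine j i
    ... | A , B , h = A , B , λ col → ∣-trans p₁∣q (h col)

    affine₂ : ∀ j i → Σ[ A ∈ ℤ ] Σ[ B ∈ ℤ ] ∀ {n} → Column N n → R₂.Null (ε n (j * n + i) - (A * n + B))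
    affine₂ j i with ε-affine j i
    ... | A , B , h = A , B , λ col → ∣-trans p₂∣q (h col)

    -- α′ is the difference of two heights in column 1 with residues 1 and 0. As α has to map it to
    -- 1, it inverts α modulo both primes at once.
    α α′ : ℤ
    α = ε 1ℤ 1ℤ - ε 1ℤ 0ℤ
    α′ = proj₁ (preimage (column 1ℤ) (suc zero)) - proj₁ (preimage (column 1ℤ) zero)

    inverse₁ : R₁.Null (α * α′ - 1ℤ)
    inverse₁ = Base₁.slope-invertible ε affine₁
      (cong int (proj₂ (preimage (column 1ℤ) zero))) (cong int (proj₂ (preimage (column 1ℤ) (suc zero))))

    inverse₂ : R₂.Null (α * α′ - 1ℤ)
    inverse₂ = Base₂.slope-invertible ε affine₂
      (cong int (proj₂ (preimage (column 1ℤ) zero))) (cong int (proj₂ (preimage (column 1ℤ) (suc zero))))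

    ρ₁ ρ₂ : ℤ → ℤ → ℤ
    ρ₁ n m = α′ * r₁ n m
    ρ₂ n m = α′ * r₂ n m

    module OnLine (j i : ℤ) where
      private
        lines = proj₂ (rule j i)
      A₁ B₁ A₂ B₂ : ℤ
      A₁ = int (proj₁ lines)
      B₁ = int (proj₁ (proj₂ lines))
      A₂ = int (proj₁ (proj₂ (proj₂ lines)))
      B₂ = int (proj₁ (proj₂ (proj₂ (proj₂ lines))))
      w₀ w₁ w₂ : W
      w₀ = proj₁ (proj₂ (proj₂ (proj₂ (proj₂ lines))))
      w₁ = proj₁ (proj₂ (proj₂ (proj₂ (proj₂ (proj₂ lines)))))
      w₂ = proj₁ (proj₂ (proj₂ (proj₂ (proj₂ (proj₂ (proj₂ lines))))))
      lineAt : LineAt (λ n → F n (j * int n + i)) A₁ B₁ A₂ B₂ w₀ w₁ w₂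
      lineAt = proj₂ (proj₂ (proj₂ (proj₂ (proj₂ (proj₂ (proj₂ lines))))))
      open LineAt lineAt public using (related₁; related₂)

      cellAt : ∀ {n} → Column N n → Cell (F (column n) (j * n + i)) (A₁ * n + B₁) (A₂ * n + B₂) w₀ w₁ w₂
      cellAt {n} col = subst (λ z → Cell (F (column n) (j * z + i)) (A₁ * z + B₁) (A₂ * z + B₂) w₀ w₁ w₂)
                             (int-column col) (LineAt.cell lineAt (column n))

      reading₁ : B₁.Reading ρ₁ j i (α′ * A₁) (α′ * B₁)
      reading₁ = Base₁.reading-scale {r₁} {α = α} inverse₁
        record { proper = LineAt.proper₁ lineAt ; reads = λ col → Cell.reads₁ (cellAt col) }

      reading₂ : B₂.Reading ρ₂ j i (α′ * A₂) (α′ * B₂)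
      reading₂ = Base₂.reading-scale {r₂} {α = α} inverse₂
        record { proper = LineAt.proper₂ lineAt ; reads = λ col → Cell.reads₂ (cellAt col) }

      private
        module C₁ = Scaling M₁ α α′ inverse₁
        module C₂ = Scaling M₂ α α′ inverse₂
        eq : ∀ c A B n → c * A * n + c * B ≡ c * (A * n + B)
        eq = solve-∀

      nonzero₁ : ∀ n → ¬ R₁.Null (α′ * A₁ * n + α′ * B₁) → ¬ R₁.Null (A₁ * n + B₁)
      nonzero₁ n ¬X nX = ¬X (R₁.null-lin₁ α′ nX (eq α′ A₁ B₁ n))

      nonzero₂ : ∀ n → ¬ R₂.Null (α′ * A₂ * n + α′ * B₂) → ¬ R₂.Null (A₂ * n + B₂)
      nonzero₂ n ¬X nX = ¬X (R₂.null-lin₁ α′ nX (eq α′ A₂ B₂ n))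

      simple₁ : ∀ n → R₁.Simple (α′ * A₁ * n + α′ * B₁) → R₁.Simple (A₁ * n + B₁)
      simple₁ n s = C₁.simple-unscale (subst R₁.Simple (eq α′ A₁ B₁ n) s)

      simple₂ : ∀ n → R₂.Simple (α′ * A₂ * n + α′ * B₂) → R₂.Simple (A₂ * n + B₂)
      simple₂ n s = C₂.simple-unscale (subst R₂.Simple (eq α′ A₂ B₂ n) s)

    line₁ : ∀ j i → S₁.HalfLine ρ₁ ρ₂ ω (λ x y → H x y ≡ true) j i
    line₁ j i = record
      { reading₁ = reading₁ ; reading₂ = reading₂ ; related = related₁
      ; at₀ = λ {n} col ¬X₁ ¬X₂ → Cell.at₀ (cellAt col) (nonzero₁ n ¬X₁) (nonzero₂ n ¬X₂)
      ; at₁ = λ {n} col s ¬X₂ → Cell.at₁ (cellAt col) (simple₁ n s) (nonzero₂ n ¬X₂) }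
      where open OnLine j i

    line₂ : ∀ j i → S₂.HalfLine ρ₂ ρ₁ ω (λ x y → V x y ≡ true) j i
    line₂ j i = record
      { reading₁ = reading₂ ; reading₂ = reading₁ ; related = related₂
      ; at₀ = λ {n} col ¬X₂ ¬X₁ → Cell.at₀ (cellAt col) (nonzero₁ n ¬X₁) (nonzero₂ n ¬X₂)
      ; at₁ = λ {n} col s ¬X₁ → Cell.at₂ (cellAt col) (simple₂ n s) (nonzero₁ n ¬X₁) }
      where open OnLine j i

    lined₁ : B₁.Lined ρ₁
    lined₁ j i = α′ * OnLine.A₁ j i , α′ * OnLine.B₁ j i , OnLine.reading₁ j i

    lined₂ : B₂.Lined ρ₂
    lined₂ j i = α′ * OnLine.A₂ j i , α′ * OnLine.B₂ j i , OnLine.reading₂ j i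

    level₁ : ∀ a → L₁.Level ρ₁ a
    level₁ zero = Base₁.base-level ε affine₁ r₁ α′ inverse₁
      (λ {n} _ m → proj₁ (proj₂ (initial (column n) m)))
    level₁ (suc a) = L₁.next lined₁ (level₁ a)

    level₂ : ∀ b → L₂.Level ρ₂ b
    level₂ zero = Base₂.base-level ε affine₂ r₂ α′ inverse₂
      (λ {n} _ m → proj₂ (proj₂ (initial (column n) m)))
    level₂ (suc b) = L₂.next lined₂ (level₂ b)

    coprime : Bezout.Coprime R₁.π R₂.π
    coprime = u , v , bezout

    crt₁ : ∀ a b X Y → Σ[ k ∈ ℤ ] Σ[ l ∈ ℤ ] X + R₁.π ^ a * k ≡ Y + R₂.π ^ b * l
    crt₁ = Bezout.crt coprime

    crt₂ : ∀ a b X Y → Σ[ k ∈ ℤ ] Σ[ l ∈ ℤ ] X + R₂.π ^ a * k ≡ Y + R₁.π ^ b * l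
    crt₂ = Bezout.crt (Bezout.coprime-sym {R₁.π} {R₂.π} coprime)

    point : ∀ a b → Σ[ m ∈ ℤ ] S₁.Point (level₁ a) (level₂ b) m
    -- The exponents are one above the levels, so that both digits can be fixed to 1 modulo their
    -- primes.
    point a b = build (crt₁ (suc a) (suc b) (I₁ + Q₁) (I₂ + Q₂))
      where
      I₁ = L₁.Level.I (level₁ a)
      I₂ = L₂.Level.I (level₂ b)
      Q₁ = R₁.π ^ a
      Q₂ = R₂.π ^ b
      eq : ∀ I Q q k → I + Q + q * Q * k ≡ I + Q * (1ℤ + k * q)
      eq = solve-∀
      eq′ : ∀ k q → 1ℤ + k * q - 1ℤ ≡ k * q
      eq′ = solve-∀
      build : (Σ[ k ∈ ℤ ] Σ[ l ∈ ℤ ] I₁ + Q₁ + R₁.π ^ suc a * k ≡ I₂ + Q₂ + R₂.π ^ suc b * l) →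
              Σ[ m ∈ ℤ ] S₁.Point (level₁ a) (level₂ b) m
      build (k , l , e) = I₁ + Q₁ + R₁.π ^ suc a * k , record
        { y₁ = 1ℤ + k * R₁.π
        ; y₂ = 1ℤ + l * R₂.π
        ; m≡₁ = eq I₁ Q₁ R₁.π k
        ; m≡₂ = trans e (eq I₂ Q₂ R₂.π l)
        ; y₁≡1 = divides k (eq′ k R₁.π)
        ; y₂≡1 = divides l (eq′ l R₂.π) }

    flip : ∀ {a b m} → S₁.Point (level₁ a) (level₂ b) m → S₂.Point (level₂ b) (level₁ a) m
    flip P = record { y₁ = y₂ ; y₂ = y₁ ; m≡₁ = m≡₂ ; m≡₂ = m≡₁ ; y₁≡1 = y₂≡1 ; y₂≡1 = y₁≡1 }
      where open S₁.Point P

    tiling : ℕ → ℕ → W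
    tiling a b = ω 0ℤ (proj₁ (point a b))

    tiling-domino : IsDominoFunctionℕ² R tiling
    tiling-domino =
        (λ a b → S₁.horizontal lined₁ line₁ crt₁ (level₁ a) (level₂ b)
                   (proj₂ (point a b)) (proj₂ (point (suc a) b)))
      , (λ a b → S₂.horizontal lined₂ line₂ crt₂ (level₂ b) (level₁ a)
                   (flip (proj₂ (point a b))) (flip (proj₂ (point a (suc b)))))

-- The numerical parameters.

mod5 mod7 : Modulus
mod5 = record
  { p = 5 ; p-nonZero = _ ; half = + 3 ; third = + 2
  ; half-inv = divides (+ 1) refl ; third-inv = divides (+ 1) refl
  ; p∤1 = toWitnessFalse {a? = + 5 ∣? 1ℤ} _ }
mod7 = record
  { p = 7 ; p-nonZero = _ ; half = + 4 ; third = + 5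
  ; half-inv = divides (+ 1) refl ; third-inv = divides (+ 2) refl
  ; p∤1 = toWitnessFalse {a? = + 7 ∣? 1ℤ} _ }

-- 5 and 7 are the least primes modulo which 2 and 3 are units; 84 = 12·7, the period is 33 + 2 =
-- 35, and 3·5 - 2·7 = 1.
frame : Frame
frame = record
  { M₁ = mod5 ; M₂ = mod7 ; N = 84
  ; wide₁ = ℕₚ.m≤m+n 60 24 ; wide₂ = ℕₚ.≤-refl
  ; q-2 = 33 ; p₁∣q = divides (+ 7) refl ; p₂∣q = divides (+ 5) refl
  ; u = + 3 ; v = - + 2 ; bezout = refl }

theorem3p2 : Σ[ f ∈ (DominoSet → SudokuPuzzle) ]
    (∀ (R : DominoSet) → DominoSolvableℕ² R ⇔ SudokuSolvable (f R))
theorem3p2 = Puzzle.puzzle frame , λ R → mk⇔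
  (λ (T , isT) → Puzzle.FromTiling.solution frame R T isT)
  (λ (F , solves , obeys) →
    FromSudoku.tiling frame R F solves obeys ,
    FromSudoku.tiling-domino frame R F solves obeys)
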